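{- Let $P$ be a finite poset having a unique minimum element $\widehat{0}$ and a rank function $\rho:P\to\mathbb{N}$ satisfying $\rho(\widehat{0})=0$, and let $n=\max\{\rho(p):p\in P\}$. Then $$ \operatorname{t}(P,x)=\sum_{S\subseteq[1,n]} f_S(P)\cdot \sum_{\substack{\lambda\in\{ -1,1\}^n:\\ S(\lambda)\supseteq S,\ n-2i_{\lambda}\geq 0}} (-1)^{n-i_{\lambda}+|S|}x^{n-2i_{\lambda}}. $$
   Context: A rank function satisfies $\rho(y)=\rho(x)+1$ whenever $y$ covers $x$. $[1,n]=\{1,\dots,n\}$, and $[\widehat{0},p)=\{q\in P:q<p\}$. For $S\subseteq[1,n]$, $f_S(P)$ is the number of maximal chains in the $S$ rank-selected subposet $P_S=\{u\in P:\rho(u)\in S\}$. For $\lambda=(\lambda_1,\dots,\lambda_n)\in\{ -1,1\}^n$, $S(\lambda)=\{s\in[1,n]:\lambda_1+\cdots+\lambda_s>0\}$ and $i_\lambda$ is the number of $-1$'s in $\lambda$. For $z\in\mathbb{Z}$, $U_{\geq z}$ is the linear operator on Laurent polynomials in $x$ discarding all terms of degree less than $z$. The short toric polynomial $\operatorname{t}(P,x)$ is defined for all finite posets $P$ having a unique minimum element $\widehat{0}$ and a rank function $\rho:P\to\mathbb{N}$ with $\rho(\widehat{0})=0$ (and for the empty poset) recursively by $\operatorname{t}(\emptyset,x)=1$ and $$ \operatorname{t}(P,x)=U_{\geq 0}\left((x^{ -1}-x)^{n} +\sum_{p\in P\setminus\{\widehat{0}\}} U_{\geq 1}\left(\operatorname{t}([\widehat{0},p),x)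 (x-x^{ -1})\right)(x^{ -1}-x)^{n-\rho(p)}\right), $$ where $n=\max\{\rho(p):p\in P\}$.
   Formalization: f_S(P) counts only the maximal chains of P_S having an element of every rank in S; counting all maximal chains makes the identity false when maximal elements of P differ in rank (e.g. 0̂<a, 0̂<b<c). The two counts agree when all maximal elements have the same rank. -}

module Defs where

open import Data.Fin.Base using (Fin; toℕ)
open import Data.Fin.Properties using (all?; any?)
open import Data.Fin.Subset
  using (Subset; _∈_; _⊆_; _⊂_; _-_; Nonempty; inside; outside)
open import Data.Fin.Subset.Induction using (⊂-wellFounded)
open import Data.Fin.Subset.Properties
  using (_∈?_; _⊆?_; _⊂?_; nonempty?; anySubset?; p─q⊆p)
open import Data.Integer.Base as ℤ using (ℤ; +_; 0ℤ; 1ℤ; -1ℤ)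
import Data.Integer.Properties as ℤ
open import Data.List.Base as List
  using (List; []; _∷_; _++_; map; concat; cartesianProductWith; filter; foldr; length; allFin)
open import Data.List.Extrema.Nat using (max)
open import Data.List.Membership.Propositional using (mapWith∈) renaming (_∈_ to _∈ˡ_)
open import Data.List.Membership.Propositional.Properties
  using (∈-filter⁻; mapWith∈-cong; mapWith∈≗map)
open import Data.Nat.Base as ℕ using (ℕ; zero; suc)
import Data.Nat.Properties as ℕ
open import Data.Product.Base using (∃; _×_; _,_; proj₁; proj₂)
open import Data.Sign.Base as Sign using (Sign)
import Data.Sign.Properties as Sign
open import Data.Sum.Base using (_⊎_)
open import Data.Vec.Base as Vec using (Vec; []; _∷_)
import Data.Vec.Properties as Vec
open import Function.Base using (_∘_)
open import Induction.WellFounded using (WfRec; module All; module FixPoint)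
open import Level using (0ℓ)
open import Relation.Binary.Core using (Rel)
open import Relation.Binary.Definitions using (Minimum)
open import Relation.Binary.PropositionalEquality
  using (_≡_; refl; sym; trans; cong)
open import Relation.Binary.Structures using (IsDecPartialOrder)
import Relation.Binary.Construct.NonStrictToStrict as NonStrict
open import Relation.Nullary.Decidable
  using (Dec; yes; no; does; ¬?; _×-dec_; _⊎-dec_; _→-dec_)
open import Relation.Nullary.Negation using (¬_; contradiction)
open import Relation.Unary using (Pred; Decidable)

-- A finite formal sum of terms (c , e), each standing for c·x^e.  Exponents
-- may repeat and coefficients may vanish, so the equality of Laurent
-- polynomials is _≈_ and not _≡_.
Laurent : Set
Laurent = List (ℤ × ℤ)

coeff : Laurent → ℤ → ℤ
coeff f d = foldr ℤ._+_ 0ℤ (map proj₁ (filter (λ t → proj₂ t ℤ.≟ d) f))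

infix 4 _≈_
_≈_ : Rel Laurent 0ℓ
f ≈ g = ∀ d → coeff f d ≡ coeff g d

monomial : ℤ → ℤ → Laurent
monomial c e = (c , e) ∷ []

infixl 6 _⊕_ _⊖_
infixl 7 _⊗_ _·_
infixr 8 _^_

_⊕_ : Laurent → Laurent → Laurent
_⊕_ = _++_

_⊗_ : Laurent → Laurent → Laurent
_⊗_ = cartesianProductWith λ (c , e) (c′ , e′) → c ℤ.* c′ , e ℤ.+ e′

_·_ : ℤ → Laurent → Laurent
a · f = map (λ (c , e) → a ℤ.* c , e) f

_⊖_ : Laurent → Laurent → Laurent
f ⊖ g = f ⊕ -1ℤ · g

1ᴸ x x⁻¹ : Laurent
1ᴸ  = monomial 1ℤ 0ℤ
x   = monomial 1ℤ 1ℤ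
x⁻¹ = monomial 1ℤ -1ℤ

_^_ : Laurent → ℕ → Laurent
f ^ zero  = 1ᴸ
f ^ suc k = f ⊗ f ^ k

U≥ : ℤ → Laurent → Laurent
U≥ z = filter λ t → z ℤ.≤? proj₂ t

∑ : ∀ {a} {A : Set a} → List A → (A → Laurent) → Laurent
∑ is f = concat (map f is)

select : ∀ {m ℓ} {Q : Pred (Fin m) ℓ} → Decidable Q → Subset m
select Q? = Vec.tabulate (does ∘ Q?)

∈-select⁻ : ∀ {m ℓ} {R : Pred (Fin m) ℓ} (R? : Decidable R) {i} →
            i ∈ select R? → R i
∈-select⁻ R? {i} i∈ with R? i in eq
... | yes r = r
... | no  _ = contradiction
  (trans (sym (Vec.[]=⇒lookup i∈))
    (trans (Vec.lookup∘tabulate (does ∘ R?) i) (cong does eq)))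
  λ ()

elements : ∀ {m} → Subset m → List (Fin m)
elements {m} Q = filter (_∈? Q) (allFin m)

vectors : ∀ {a} {A : Set a} → List A → ∀ n → List (Vec A n)
vectors as zero    = [] ∷ []
vectors as (suc n) = cartesianProductWith _∷_ as (vectors as n)

subsets : ∀ n → List (Subset n)
subsets = vectors (inside ∷ outside ∷ [])

signVectors : ∀ n → List (Vec Sign n)
signVectors = vectors (Sign.- ∷ Sign.+ ∷ [])

partialSum : ∀ {n} → Vec Sign n → ℕ → ℤ
partialSum λs s = foldr ℤ._+_ 0ℤ (List.take s (map (ℤ._◃ 1) (Vec.toList λs)))

-- Here and below, a subset of [1,n] is encoded as a Subset n, with i : Fin n
-- standing for the number suc (toℕ i).
positiveSums : ∀ {n} → Vec Sign n → Subset n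
positiveSums λs = select λ i → 0ℤ ℤ.<? partialSum λs (suc (toℕ i))

minuses : ∀ {n} → Vec Sign n → ℕ
minuses = Vec.count (Sign._≟ Sign.-)

record RankedPoset : Set₁ where
  infix 4 _⊑_
  field
    size              : ℕ
    _⊑_               : Rel (Fin size) 0ℓ
    isDecPartialOrder : IsDecPartialOrder _≡_ _⊑_

  open NonStrict _≡_ _⊑_ public using () renaming (_<_ to _⊏_)

  _Covers_ : Rel (Fin size) 0ℓ
  q Covers p = p ⊏ q × (∀ r → ¬ (p ⊏ r × r ⊏ q))

  field
    0̂      : Fin size
    minimum : Minimum _⊑_ 0̂
    ρ       : Fin size → ℕ
    ρ-0̂    : ρ 0̂ ≡ 0
    ρ-cover : ∀ {p q} → q Covers p → ρ q ≡ suc (ρ p)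

  open IsDecPartialOrder isDecPartialOrder public
    using (_≟_) renaming (_≤?_ to _⊑?_)

  _⊏?_ : ∀ p q → Dec (p ⊏ q)
  _⊏?_ = NonStrict.<-decidable _≡_ _⊑_ _≟_ _⊑?_

module _ (P : RankedPoset) where
  open RankedPoset P

  maxRank : Subset size → ℕ
  maxRank Q = max 0 (map ρ (elements Q))

  -- The recursion passes from P to the subposets [0̂,p), so it is set up on
  -- subsets Q of P with the induced order and the restriction of ρ.  Only
  -- Q = ∅ and down-closed Q are meaningful: then covers in Q are covers
  -- in P, and 0̂ is the minimum of Q unless Q is empty.

  below : Subset size → Fin size → Subset size
  below Q p = select λ q → (q ∈? Q) ×-dec (q ⊏? p)

  private
    below-⊂ : ∀ Q {p} → p ∈ˡ elements (Q - 0̂) → below Q p ⊂ Q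
    below-⊂ Q {p} p∈ =
        (λ q∈ → proj₁ (∈-select⁻ (λ q → (q ∈? Q) ×-dec (q ⊏? p)) q∈))
      , p
      , p─q⊆p Q _ (proj₂ (∈-filter⁻ (_∈? (Q - 0̂)) {xs = allFin size} p∈))
      , λ p∈below → proj₂ (proj₂
          (∈-select⁻ (λ q → (q ∈? Q) ×-dec (q ⊏? p)) p∈below)) refl

  toricSummand : ℕ → Fin size → Laurent → Laurent
  toricSummand n p t[0̂,p⟩ =
    U≥ 1ℤ (t[0̂,p⟩ ⊗ (x ⊖ x⁻¹)) ⊗ (x⁻¹ ⊖ x) ^ (n ℕ.∸ ρ p)

  private
    toricStep : ∀ Q → WfRec _⊂_ (λ _ → Laurent) Q → Laurent
    toricStep Q rec with nonempty? Q
    ... | no  _ = 1ᴸ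
    ... | yes _ = let n = maxRank Q in
      U≥ 0ℤ ((x⁻¹ ⊖ x) ^ n
             ⊕ concat (mapWith∈ (elements (Q - 0̂)) λ {p} p∈ →
                 toricSummand n p (rec (below-⊂ Q p∈))))

  toric : Subset size → Laurent
  toric = All.wfRec ⊂-wellFounded 0ℓ (λ _ → Laurent) toricStep

  private
    toricStep-ext : ∀ Q {rec rec′ : WfRec _⊂_ (λ _ → Laurent) Q} →
                    (∀ {R} (R⊂Q : R ⊂ Q) → rec R⊂Q ≡ rec′ R⊂Q) →
                    toricStep Q rec ≡ toricStep Q rec′
    toricStep-ext Q eq with nonempty? Q
    ... | no  _ = refl
    ... | yes _ = cong (λ s → U≥ 0ℤ ((x⁻¹ ⊖ x) ^ maxRank Q ⊕ concat s))
      (mapWith∈-cong (elements (Q - 0̂)) _ _ λ {p} p∈ →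
        cong (toricSummand (maxRank Q) p) (eq (below-⊂ Q p∈)))

    toric-unfold : ∀ Q → toric Q ≡ toricStep Q (λ {R} _ → toric R)
    toric-unfold Q =
      FixPoint.unfold-wfRec ⊂-wellFounded (λ _ → Laurent) toricStep toricStep-ext

  toric-∅ : ∀ {Q} → ¬ Nonempty Q → toric Q ≡ 1ᴸ
  toric-∅ {Q} Q≡∅ rewrite toric-unfold Q with nonempty? Q
  ... | yes q = contradiction q Q≡∅
  ... | no  _ = refl

  toric-rec : ∀ {Q} → Nonempty Q → let n = maxRank Q in
    toric Q ≡ U≥ 0ℤ ((x⁻¹ ⊖ x) ^ n
                     ⊕ ∑ (elements (Q - 0̂)) λ p →
                         U≥ 1ℤ (toric (below Q p) ⊗ (x ⊖ x⁻¹))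
                         ⊗ (x⁻¹ ⊖ x) ^ (n ℕ.∸ ρ p))
  toric-rec {Q} Q≢∅ rewrite toric-unfold Q with nonempty? Q
  ... | no  ¬q = contradiction Q≢∅ ¬q
  ... | yes _  = cong (λ s → U≥ 0ℤ ((x⁻¹ ⊖ x) ^ maxRank Q ⊕ concat s))
    (mapWith∈≗map (λ p → toricSummand (maxRank Q) p (toric (below Q p)))
                  (elements (Q - 0̂)))

  rankSelected : ∀ {n} → Subset n → Subset size
  rankSelected S = select λ u → any? λ i → (i ∈? S) ×-dec (ρ u ℕ.≟ suc (toℕ i))

  IsChain : Pred (Subset size) 0ℓ
  IsChain C = ∀ p q → p ∈ C → q ∈ C → p ⊑ q ⊎ q ⊑ p

  isChain? : Decidable IsChain
  isChain? C = all? λ p → all? λ q →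
    (p ∈? C) →-dec ((q ∈? C) →-dec ((p ⊑? q) ⊎-dec (q ⊑? p)))

  IsChainOf : Subset size → Pred (Subset size) 0ℓ
  IsChainOf Q C = C ⊆ Q × IsChain C

  isChainOf? : ∀ Q → Decidable (IsChainOf Q)
  isChainOf? Q C = (C ⊆? Q) ×-dec isChain? C

  IsMaximalChainOf : Subset size → Pred (Subset size) 0ℓ
  IsMaximalChainOf Q C = IsChainOf Q C × ¬ (∃ λ D → IsChainOf Q D × C ⊂ D)

  isMaximalChainOf? : ∀ Q → Decidable (IsMaximalChainOf Q)
  isMaximalChainOf? Q C =
    isChainOf? Q C ×-dec ¬? (anySubset? λ D → isChainOf? Q D ×-dec (C ⊂? D))

  MeetsRanks : ∀ {n} → Subset n → Pred (Subset size) 0ℓ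
  MeetsRanks S C = ∀ i → i ∈ S → ∃ λ u → u ∈ C × ρ u ≡ suc (toℕ i)

  meetsRanks? : ∀ {n} (S : Subset n) → Decidable (MeetsRanks S)
  meetsRanks? S C = all? λ i →
    (i ∈? S) →-dec any? λ u → (u ∈? C) ×-dec (ρ u ℕ.≟ suc (toℕ i))

  -- f_S(P) is the flag f-number: it counts the maximal chains of P_S having
  -- an element of every rank in S.  If all maximal elements of P have the
  -- same rank, every maximal chain of P_S is of this kind.  Otherwise P_S
  -- may also have shorter inclusion-maximal chains, and these do not count:
  -- for P = {0̂, a, b, c} with 0̂ ⊏ a and 0̂ ⊏ b ⊏ c, the chain {a} is maximal
  -- in P_{1,2}, but f_{1,2}(P) = 1, from {b, c}.
  flagNumber : ∀ {n} → Subset n → ℕ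
  flagNumber S = length (filter
    (λ C → isMaximalChainOf? (rankSelected S) C ×-dec meetsRanks? S C)
    (subsets size))

{-# OPTIONS --safe #-}

-- Expanding (x⁻¹ - x)ⁿ gives a signed sum over walks λ ∈ {-1,1}ⁿ.  Unfolding
-- the recursion of t down to 0̂ gives a sum over the chains C of P∖{0̂}: every
-- p ∈ C of rank r contributes one truncation U≥1 and one sign, applied after r
-- steps, which says that λ₁+⋯+λᵣ > 0.  The inner truncation U≥0 is absorbed by
-- the U≥1 that follows it, one step later.  So the contribution of C depends
-- only on the set S of its ranks, and f_S(P) counts the chains with rank set S.
-- One step of the recursion splits a nonempty chain into its top element p and
-- a chain of [0̂,p)∖{0̂}.
module Submission where

open import Defs
open import Algebra.Properties.AbelianGroup using (∙-cancelʳ)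
open import Data.Bool.Base using (Bool; true; false; if_then_else_; not; _∧_)
open import Data.Fin.Base as Fin using (Fin; zero; suc; toℕ)
open import Data.Fin.Induction using (po-wellFounded; po-noetherian)
open import Data.Fin.Properties using (any?; all?; toℕ-injective; toℕ-fromℕ<)
open import Data.Fin.Subset using (⊤; ∣_∣)
open import Data.Fin.Subset using (Subset; _∈_; _⊆_; _⊂_; ⊥; _-_; _─_; Nonempty; inside; outside)
open import Data.Fin.Subset.Induction using (⊂-wellFounded)
open import Data.Fin.Subset.Properties using (_⊆?_)
open import Data.Fin.Subset.Properties using (_∈?_; nonempty?; ∉⊥; ∈⊤; Empty-unique)
open import Data.Fin.Subset.Properties using (⊆-antisym; p─q⊆p; x∈⁅x⁆; x∈p∧x≢y⇒x∈p-y)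
open import Data.Integer.Base as ℤ using (ℤ; +_; 0ℤ; 1ℤ; -1ℤ)
open import Data.Integer.Properties as ℤ using (_≤?_)
open import Data.Integer.Tactic.RingSolver using (solve-∀)
open import Data.List.Base as List using (List; []; _∷_; _++_; map; foldr; length)
open import Data.List.Base using (filter; cartesianProductWith)
open import Data.List.Extrema.Nat using (xs≤max; max≤v⁺)
open import Data.List.Membership.Propositional using () renaming (_∈_ to _∈ˡ_)
open import Data.List.Membership.Propositional.Properties using (∈-map⁺; ∈-map⁻; ∈-allFin)
open import Data.List.Membership.Propositional.Properties using (∈-filter⁺; ∈-filter⁻)
open import Data.List.Membership.Propositional.Properties using (∈-cartesianProductWith⁺)
open import Data.List.Relation.Unary.All as All using ([]; _∷_)
open import Data.List.Relation.Unary.AllPairs using ([]; _∷_)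
open import Data.List.Relation.Unary.Any using (here; there)
open import Data.List.Relation.Unary.Unique.Propositional using (Unique)
import Data.List.Relation.Unary.Unique.Propositional.Properties as Unique
open import Data.Nat.Base as ℕ using (ℕ; zero; suc)
import Data.Nat.Properties as ℕ
open import Data.Product.Base using (_×_; _,_; proj₁; proj₂; ∃)
open import Data.Sign.Base as Sign using (Sign)
import Data.Sign.Properties as Sign
open import Data.Sum.Base using (_⊎_; inj₁; inj₂)
open import Data.Vec.Base as Vec using (Vec; []; _∷_; _[_]≔_; tabulate)
import Data.Vec.Properties as Vec
open import Function.Base using (_∘_; flip)
open import Function.Bundles using (_⇔_; mk⇔; module Equivalence)
open import Induction.WellFounded using (Acc; acc)
open import Level using (Level)
open import Relation.Binary.PropositionalEquality
open import Relation.Binary.Structures using (IsDecPartialOrder)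
open import Relation.Nullary.Decidable using (_×-dec_)
open import Relation.Nullary.Decidable using (Dec; yes; no; does; ¬?; _→-dec_)
open import Relation.Nullary.Decidable using (dec-true; dec-false; does-⇔)
open import Relation.Nullary.Negation using (¬_; contradiction)
open import Relation.Unary using (Pred; Decidable)
open ≡-Reasoning

-- Truncation does not commute with multiplication, so the recursion cannot be expanded as a product
-- of polynomials. On coefficient functions `ℤ → ℤ`, multiplication by x⁻¹ - x is a difference
-- operator and a truncation is a pointwise factor 0 or 1; the order in which these operators are
-- composed is the order of time along the walk. The sign attached to p comes from x - x⁻¹ = -(x⁻¹ -
-- x). Each upward step carries a further -1, since it selects the term -x, and n - i such steps
-- give the rest of the sign in the theorem.
--
-- After multiplication by x - x⁻¹, the coefficients of degree at least 1 depend only on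
-- coefficients of degree at least 0; this is why the inner U≥0 loses nothing. The timing rests on
-- [0̂,p) having top rank ρ(p) - 1: its walks use ρ(p) - 1 steps, the factor x - x⁻¹ is step number
-- ρ(p), and n - ρ(p) free steps remain. This holds for every p other than 0̂, even when the maximal
-- elements of P have different ranks.

private variable
  ℓ : Level
  A B C : Set

-- Guarded integers and finite sums

infixr 5 _⊳_
-- An Iverson bracket times `z`. Filters, truncations and chain conditions all become such factors,
-- so that sums can be exchanged over fixed enumerations.
_⊳_ : Bool → ℤ → ℤ
b ⊳ z = if b then z else 0ℤ

⊳-0 : ∀ b → b ⊳ 0ℤ ≡ 0ℤ
⊳-0 false = refl
⊳-0 true  = refl

⊳-comm : ∀ a b z → (a ⊳ b ⊳ z) ≡ (b ⊳ a ⊳ z)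
⊳-comm false b z = sym (⊳-0 b)
⊳-comm true  b z = refl

*-⊳ : ∀ a b z → a ℤ.* (b ⊳ z) ≡ (b ⊳ a ℤ.* z)
*-⊳ a false z = ℤ.*-zeroʳ a
*-⊳ a true  z = refl

⊳-yes : (a? : Dec A) {z : ℤ} → A → (does a? ⊳ z) ≡ z
⊳-yes a? {z} a = cong (_⊳ z) (dec-true a? a)

⊳-no : (a? : Dec A) {z : ℤ} → ¬ A → (does a? ⊳ z) ≡ 0ℤ
⊳-no a? {z} ¬a = cong (_⊳ z) (dec-false a? ¬a)

⊳-cong : (a? : Dec A) {y z : ℤ} → (A → y ≡ z) → (does a? ⊳ y) ≡ (does a? ⊳ z)
⊳-cong (yes a) eq = eq a
⊳-cong (no _)  eq = refl

sum : List A → (A → ℤ) → ℤ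
sum is f = foldr ℤ._+_ 0ℤ (map f is)

sum-cong : ∀ (is : List A) {f g : A → ℤ} → (∀ {i} → i ∈ˡ is → f i ≡ g i) → sum is f ≡ sum is g
sum-cong []       eq = refl
sum-cong (i ∷ is) eq = cong₂ ℤ._+_ (eq (here refl)) (sum-cong is (eq ∘ there))

sum-≗ : ∀ (is : List A) {f g : A → ℤ} → f ≗ g → sum is f ≡ sum is g
sum-≗ is eq = sum-cong is λ {i} _ → eq i

sum-≡0 : ∀ (is : List A) {f : A → ℤ} → (∀ {i} → i ∈ˡ is → f i ≡ 0ℤ) → sum is f ≡ 0ℤ
sum-≡0 []       eq = refl
sum-≡0 (i ∷ is) eq = cong₂ ℤ._+_ (eq (here refl)) (sum-≡0 is (eq ∘ there))

sum-++ : ∀ (is js : List A) (f : A → ℤ) → sum (is ++ js) f ≡ sum is f ℤ.+ sum js f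
sum-++ []       js f = sym (ℤ.+-identityˡ _)
sum-++ (i ∷ is) js f = trans (cong (ℤ._+_ (f i)) (sum-++ is js f)) (sym (ℤ.+-assoc (f i) _ _))

sum-map : ∀ (g : A → B) is (f : B → ℤ) → sum (map g is) f ≡ sum is (f ∘ g)
sum-map g []       f = refl
sum-map g (i ∷ is) f = cong (ℤ._+_ (f (g i))) (sum-map g is f)

sum-∑ : ∀ (is : List A) (g : A → Laurent) f → sum (∑ is g) f ≡ sum is (λ i → sum (g i) f)
sum-∑ []       g f = refl
sum-∑ (i ∷ is) g f = trans (sum-++ (g i) _ f) (cong (ℤ._+_ (sum (g i) f)) (sum-∑ is g f))

sum-cartesianProductWith : ∀ (h : A → B → C) is js (f : C → ℤ) →
  sum (cartesianProductWith h is js) f ≡ sum is (λ i → sum js (λ j → f (h i j)))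
sum-cartesianProductWith h []       js f = refl
sum-cartesianProductWith h (i ∷ is) js f = trans (sum-++ (map (h i) js) _ f)
  (cong₂ ℤ._+_ (sum-map (h i) js f) (sum-cartesianProductWith h is js f))

sum-filter : ∀ {P : Pred A ℓ} (P? : Decidable P) is (f : A → ℤ) →
  sum (filter P? is) f ≡ sum is (λ i → does (P? i) ⊳ f i)
sum-filter P? []       f = refl
sum-filter P? (i ∷ is) f with does (P? i)
... | true  = cong (ℤ._+_ (f i)) (sum-filter P? is f)
... | false = trans (sum-filter P? is f) (sym (ℤ.+-identityˡ _))

sum-+ : ∀ (is : List A) (f g : A → ℤ) → sum is (λ i → f i ℤ.+ g i) ≡ sum is f ℤ.+ sum is g
sum-+ []       f g = refl
sum-+ (i ∷ is) f g = trans (cong (λ s → f i ℤ.+ g i ℤ.+ s) (sum-+ is f g)) (interchange (f i) (g i) _ _)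
  where
  interchange : ∀ a b c d → a ℤ.+ b ℤ.+ (c ℤ.+ d) ≡ a ℤ.+ c ℤ.+ (b ℤ.+ d)
  interchange = solve-∀

*-sum : ∀ a (is : List A) (f : A → ℤ) → a ℤ.* sum is f ≡ sum is (λ i → a ℤ.* f i)
*-sum a []       f = ℤ.*-zeroʳ a
*-sum a (i ∷ is) f = trans (ℤ.*-distribˡ-+ a (f i) _) (cong (ℤ._+_ (a ℤ.* f i)) (*-sum a is f))

sum-⊳ : ∀ b (is : List A) (f : A → ℤ) → (b ⊳ sum is f) ≡ sum is (λ i → b ⊳ f i)
sum-⊳ false is f = sym (sum-≡0 is λ _ → refl)
sum-⊳ true  is f = refl

sum-comm : ∀ (is : List A) (js : List B) (f : A → B → ℤ) →
  sum is (λ i → sum js (f i)) ≡ sum js (λ j → sum is (λ i → f i j))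
sum-comm []       js f = sym (sum-≡0 js λ _ → refl)
sum-comm (i ∷ is) js f =
  trans (cong (ℤ._+_ (sum js (f i))) (sum-comm is js f)) (sym (sum-+ js (f i) λ j → sum is λ i → f i j))

-- Turns existence and uniqueness into an equation of sums; it serves for the top of a chain, for
-- the empty chain and for the rank set of a chain.
sum-unique : ∀ {is : List A} {k} (f : A → ℤ) → Unique is → k ∈ˡ is →
  (∀ {i} → i ∈ˡ is → i ≢ k → f i ≡ 0ℤ) → sum is f ≡ f k
sum-unique {is = i ∷ is} f (i∉ ∷ u) (here refl) eq = trans
  (cong (ℤ._+_ (f i)) (sum-≡0 is λ j∈ → eq (there j∈) λ j≡i → All.lookup i∉ j∈ (sym j≡i)))
  (ℤ.+-identityʳ (f i))
sum-unique {is = i ∷ is} f (i∉ ∷ u) (there k∈) eq = trans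
  (cong₂ ℤ._+_ (eq (here refl) (All.lookup i∉ k∈)) (sum-unique f u k∈ (eq ∘ there)))
  (ℤ.+-identityˡ _)

length-filter-* : ∀ {P : Pred A ℓ} (P? : Decidable P) is z →
  + length (filter P? is) ℤ.* z ≡ sum is (λ i → does (P? i) ⊳ z)
length-filter-* P? []       z = refl
length-filter-* P? (i ∷ is) z with does (P? i)
... | false = trans (length-filter-* P? is z) (sym (ℤ.+-identityˡ _))
... | true  = trans (ℤ.suc-* (+ length (filter P? is)) z) (cong (ℤ._+_ z) (length-filter-* P? is z))

-- Enumeration of subsets

sides : List Bool
sides = inside ∷ outside ∷ []

∈-subsets : ∀ {n} (S : Subset n) → S ∈ˡ subsets n
∈-subsets []            = here refl
∈-subsets (inside ∷ S)  = ∈-cartesianProductWith⁺ _∷_ {xs = sides} (here refl) (∈-subsets S)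
∈-subsets (outside ∷ S) = ∈-cartesianProductWith⁺ _∷_ {xs = sides} (there (here refl)) (∈-subsets S)

subsets-unique : ∀ n → Unique (subsets n)
subsets-unique zero    = [] ∷ []
subsets-unique (suc n) = Unique.cartesianProductWith⁺ _∷_ Vec.∷-injective
  (((λ ()) ∷ []) ∷ [] ∷ []) (subsets-unique n)

-- Coefficients of Laurent polynomials

δ : ℤ → ℤ → ℤ
δ e d = does (e ℤ.≟ d) ⊳ 1ℤ

δ-+ : ∀ k e d → δ (e ℤ.+ k) (d ℤ.+ k) ≡ δ e d
δ-+ k e d = cong (_⊳ 1ℤ)
  (does-⇔ (mk⇔ (∙-cancelʳ ℤ.+-0-abelianGroup k e d) (cong (ℤ._+ k))) (_ ℤ.≟ _) (e ℤ.≟ d))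

-- ⟦ f ⟧ F is the coefficient function of f times the Laurent polynomial with
-- coefficient function F.
⟦_⟧ : Laurent → (ℤ → ℤ) → ℤ → ℤ
⟦ f ⟧ F d = sum f λ (c , e) → c ℤ.* F (d ℤ.- e)

coeff-sum : ∀ f d → coeff f d ≡ sum f (λ (c , e) → does (e ℤ.≟ d) ⊳ c)
coeff-sum f d = sum-filter (λ t → proj₂ t ℤ.≟ d) f proj₁

coeff-⟦⟧ : ∀ f → coeff f ≗ ⟦ f ⟧ (δ 0ℤ)
coeff-⟦⟧ f d = trans (coeff-sum f d) (sum-≗ f λ (c , e) → begin
  (does (e ℤ.≟ d) ⊳ c)          ≡⟨ cong (does (e ℤ.≟ d) ⊳_) (ℤ.*-identityʳ c) ⟨
  (does (e ℤ.≟ d) ⊳ c ℤ.* 1ℤ)   ≡⟨ *-⊳ c _ 1ℤ ⟨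
  c ℤ.* δ e d                   ≡⟨ cong (c ℤ.*_) (δ-+ (ℤ.- e) e d) ⟨
  c ℤ.* δ (e ℤ.- e) (d ℤ.- e)   ≡⟨ cong (λ k → c ℤ.* δ k (d ℤ.- e)) (ℤ.+-inverseʳ e) ⟩
  c ℤ.* δ 0ℤ (d ℤ.- e)          ∎)

⟦⟧-cong : ∀ f {F G} → F ≗ G → ⟦ f ⟧ F ≗ ⟦ f ⟧ G
⟦⟧-cong f eq d = sum-≗ f λ (c , e) → cong (c ℤ.*_) (eq (d ℤ.- e))

⟦⟧-⊗ : ∀ f g F → ⟦ f ⊗ g ⟧ F ≗ ⟦ g ⟧ (⟦ f ⟧ F)
⟦⟧-⊗ f g F d = begin
  ⟦ f ⊗ g ⟧ F d
    ≡⟨ sum-cartesianProductWith _ f g _ ⟩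
  sum f (λ (c , e) → sum g (λ (c′ , e′) → c ℤ.* c′ ℤ.* F (d ℤ.- (e ℤ.+ e′))))
    ≡⟨ sum-comm f g (λ (c , e) (c′ , e′) → c ℤ.* c′ ℤ.* F (d ℤ.- (e ℤ.+ e′))) ⟩
  sum g (λ (c′ , e′) → sum f (λ (c , e) → c ℤ.* c′ ℤ.* F (d ℤ.- (e ℤ.+ e′))))
    ≡⟨ sum-≗ g (λ (c′ , e′) → trans
         (sum-≗ f (λ (c , e) → trans
            (cong (λ k → c ℤ.* c′ ℤ.* F k) (assoc d e e′)) (comm c c′ _)))
         (sym (*-sum c′ f _))) ⟩
  ⟦ g ⟧ (⟦ f ⟧ F) d ∎
  where
  assoc : ∀ d e e′ → d ℤ.- (e ℤ.+ e′) ≡ d ℤ.- e′ ℤ.- e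
  assoc = solve-∀
  comm : ∀ a b c → a ℤ.* b ℤ.* c ≡ b ℤ.* (a ℤ.* c)
  comm = solve-∀

-- The left factor enters only through its coefficients, while the right one acts as an operator. In
-- the recursion the left factors are the truncated ones and the right factors are explicit.
coeff-⊗ : ∀ f g → coeff (f ⊗ g) ≗ ⟦ g ⟧ (coeff f)
coeff-⊗ f g d = begin
  coeff (f ⊗ g) d            ≡⟨ coeff-⟦⟧ (f ⊗ g) d ⟩
  ⟦ f ⊗ g ⟧ (δ 0ℤ) d         ≡⟨ ⟦⟧-⊗ f g (δ 0ℤ) d ⟩
  ⟦ g ⟧ (⟦ f ⟧ (δ 0ℤ)) d     ≡⟨ ⟦⟧-cong g (sym ∘ coeff-⟦⟧ f) d ⟩
  ⟦ g ⟧ (coeff f) d          ∎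

coeff-⊕ : ∀ f g d → coeff (f ⊕ g) d ≡ coeff f d ℤ.+ coeff g d
coeff-⊕ f g d rewrite coeff-sum (f ⊕ g) d | coeff-sum f d | coeff-sum g d = sum-++ f g _

coeff-∑ : ∀ (is : List A) f d → coeff (∑ is f) d ≡ sum is (λ i → coeff (f i) d)
coeff-∑ is f d = trans (coeff-sum (∑ is f) d)
  (trans (sum-∑ is f _) (sum-≗ is λ i → sym (coeff-sum (f i) d)))

coeff-· : ∀ a f d → coeff (a · f) d ≡ a ℤ.* coeff f d
coeff-· a f d = begin
  coeff (a · f) d                                    ≡⟨ coeff-sum (a · f) d ⟩
  sum (a · f) (λ (c , e) → does (e ℤ.≟ d) ⊳ c)       ≡⟨ sum-map _ f _ ⟩
  sum f (λ (c , e) → does (e ℤ.≟ d) ⊳ a ℤ.* c)       ≡⟨ sum-≗ f (λ (c , e) → sym (*-⊳ a _ c)) ⟩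
  sum f (λ (c , e) → a ℤ.* (does (e ℤ.≟ d) ⊳ c))     ≡⟨ *-sum a f _ ⟨
  a ℤ.* sum f (λ (c , e) → does (e ℤ.≟ d) ⊳ c)       ≡⟨ cong (a ℤ.*_) (coeff-sum f d) ⟨
  a ℤ.* coeff f d                                    ∎

coeff-U≥ : ∀ z f d → coeff (U≥ z f) d ≡ (does (z ℤ.≤? d) ⊳ coeff f d)
coeff-U≥ z f d = begin
  coeff (U≥ z f) d
    ≡⟨ coeff-sum (U≥ z f) d ⟩
  sum (U≥ z f) (λ (c , e) → does (e ℤ.≟ d) ⊳ c)
    ≡⟨ sum-filter (λ t → z ℤ.≤? proj₂ t) f _ ⟩
  sum f (λ (c , e) → does (z ℤ.≤? e) ⊳ does (e ℤ.≟ d) ⊳ c)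
    ≡⟨ sum-≗ f (λ (c , e) → swap c e) ⟩
  sum f (λ (c , e) → does (z ℤ.≤? d) ⊳ does (e ℤ.≟ d) ⊳ c)
    ≡⟨ sum-⊳ (does (z ℤ.≤? d)) f _ ⟨
  (does (z ℤ.≤? d) ⊳ sum f (λ (c , e) → does (e ℤ.≟ d) ⊳ c))
    ≡⟨ cong (does (z ℤ.≤? d) ⊳_) (coeff-sum f d) ⟨
  (does (z ℤ.≤? d) ⊳ coeff f d) ∎
  where
  swap : ∀ c e → (does (z ℤ.≤? e) ⊳ does (e ℤ.≟ d) ⊳ c) ≡ (does (z ℤ.≤? d) ⊳ does (e ℤ.≟ d) ⊳ c)
  swap c e with e ℤ.≟ d
  ... | yes refl = refl
  ... | no  _    = trans (⊳-0 _) (sym (⊳-0 _))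

-- Multiplication by x⁻¹ - x: the coefficient at d + 1 moves down to d, and the one at d - 1 moves
-- up with a minus sign.
Δ : (ℤ → ℤ) → ℤ → ℤ
Δ F d = F (d ℤ.+ 1ℤ) ℤ.- F (d ℤ.- 1ℤ)

Δ^ : ℕ → (ℤ → ℤ) → ℤ → ℤ
Δ^ zero    F = F
Δ^ (suc k) F = Δ^ k (Δ F)

Δ-cong : ∀ {F G} → F ≗ G → Δ F ≗ Δ G
Δ-cong eq d = cong₂ ℤ._-_ (eq _) (eq _)

Δ^-cong : ∀ k {F G} → F ≗ G → Δ^ k F ≗ Δ^ k G
Δ^-cong zero    eq = eq
Δ^-cong (suc k) eq = Δ^-cong k (Δ-cong eq)

⟦x⁻¹⊖x⟧ : ∀ F → ⟦ x⁻¹ ⊖ x ⟧ F ≗ Δ F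
⟦x⁻¹⊖x⟧ F d = ring (F (d ℤ.+ 1ℤ)) (F (d ℤ.- 1ℤ))
  where
  ring : ∀ a b → 1ℤ ℤ.* a ℤ.+ (-1ℤ ℤ.* b ℤ.+ 0ℤ) ≡ a ℤ.- b
  ring = solve-∀

-- This minus sign is the one that `tilt` records at a marked time.
⟦x⊖x⁻¹⟧ : ∀ F d → ⟦ x ⊖ x⁻¹ ⟧ F d ≡ ℤ.- Δ F d
⟦x⊖x⁻¹⟧ F d = ring (F (d ℤ.+ 1ℤ)) (F (d ℤ.- 1ℤ))
  where
  ring : ∀ a b → 1ℤ ℤ.* b ℤ.+ (-1ℤ ℤ.* a ℤ.+ 0ℤ) ≡ ℤ.- (a ℤ.- b)
  ring = solve-∀

⟦⟧-^ : ∀ k F → ⟦ (x⁻¹ ⊖ x) ^ k ⟧ F ≗ Δ^ k F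
⟦⟧-^ zero    F d = trans (ℤ.+-identityʳ _) (trans (ℤ.*-identityˡ _) (cong F (ℤ.+-identityʳ d)))
⟦⟧-^ (suc k) F d = trans (⟦⟧-⊗ (x⁻¹ ⊖ x) ((x⁻¹ ⊖ x) ^ k) F d)
  (trans (⟦⟧-^ k _ d) (Δ^-cong k (⟦x⁻¹⊖x⟧ F) d))

-- Signed walks

-- At the times in S only the positions d > 0 survive; the sign supplies the
-- factor (-1)^|S|.
tilt : Bool → ℤ → ℤ
tilt false d = 1ℤ
tilt true  d = does (0ℤ ℤ.<? d) ⊳ -1ℤ

-- `tilt` is evaluated at the position reached by the step, just as U≥1 follows the multiplication
-- by x - x⁻¹.
step : Bool → (ℤ → ℤ) → ℤ → ℤ
step b F d = tilt b d ℤ.* Δ F d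

-- A j refers to time suc j, as in the encoding of subsets of [1,n].
walk : (ℕ → Bool) → ℕ → (ℤ → ℤ) → ℤ → ℤ
walk A zero    F = F
walk A (suc n) F = walk (A ∘ suc) n (step (A 0) F)

step-cong : ∀ b {F G} → F ≗ G → step b F ≗ step b G
step-cong b eq d = cong (tilt b d ℤ.*_) (Δ-cong eq d)

-- Agreement is asked only at the indices `j < n`: inserting a new top element of rank `suc r` then
-- leaves the first `r` steps unchanged.
walk-cong : ∀ {A B} n {F G} → (∀ {j} → j ℕ.< n → A j ≡ B j) → F ≗ G → walk A n F ≗ walk B n G
walk-cong         zero            A≡B F≗G = F≗G
walk-cong {A} {B} (suc n) {F} {G} A≡B F≗G = walk-cong n (A≡B ∘ ℕ.s≤s)
  λ d → trans (cong (λ b → step b F d) (A≡B ℕ.z<s)) (step-cong (B 0) F≗G d)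

step-* : ∀ b a F d → step b (λ d → a ℤ.* F d) d ≡ a ℤ.* step b F d
step-* b a F d = ring a (tilt b d) (F (d ℤ.+ 1ℤ)) (F (d ℤ.- 1ℤ))
  where
  ring : ∀ a t u v → t ℤ.* (a ℤ.* u ℤ.- a ℤ.* v) ≡ a ℤ.* (t ℤ.* (u ℤ.- v))
  ring = solve-∀

walk-* : ∀ A n a F d → walk A n (λ d → a ℤ.* F d) d ≡ a ℤ.* walk A n F d
walk-* A zero    a F d = refl
walk-* A (suc n) a F d = trans (walk-cong n (λ _ → refl) (step-* (A 0) a F) d)
  (walk-* (A ∘ suc) n a (step (A 0) F) d)

Δ-sum : ∀ {J : Set} (is : List J) (F : J → ℤ → ℤ) d →
  Δ (λ d → sum is (λ i → F i d)) d ≡ sum is (λ i → Δ (F i) d)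
Δ-sum []       F d = refl
Δ-sum (i ∷ is) F d = trans
  (ring (F i (d ℤ.+ 1ℤ)) (sum is λ i → F i (d ℤ.+ 1ℤ)) (F i (d ℤ.- 1ℤ)) (sum is λ i → F i (d ℤ.- 1ℤ)))
  (cong (ℤ._+_ (Δ (F i) d)) (Δ-sum is F d))
  where
  ring : ∀ a b c d → a ℤ.+ b ℤ.- (c ℤ.+ d) ≡ a ℤ.- c ℤ.+ (b ℤ.- d)
  ring = solve-∀

walk-⊳ : ∀ A n b F d → walk A n (λ d → b ⊳ F d) d ≡ (b ⊳ walk A n F d)
walk-⊳ A n true  F d = refl
walk-⊳ A n false F d = trans (walk-cong n (λ _ → refl) (λ _ → refl) d) (walk-* A n 0ℤ F d)

step-sum : ∀ {J : Set} b (is : List J) (F : J → ℤ → ℤ) d →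
  step b (λ d → sum is (λ i → F i d)) d ≡ sum is (λ i → step b (F i) d)
step-sum b is F d = trans (cong (tilt b d ℤ.*_) (Δ-sum is F d)) (*-sum (tilt b d) is λ i → Δ (F i) d)

walk-sum : ∀ {J : Set} A n (is : List J) (F : J → ℤ → ℤ) d →
  walk A n (λ d → sum is (λ i → F i d)) d ≡ sum is (λ i → walk A n (F i) d)
walk-sum A zero    is F d = refl
walk-sum A (suc n) is F d = trans (walk-cong n (λ _ → refl) (step-sum (A 0) is F) d)
  (walk-sum (A ∘ suc) n is (λ i → step (A 0) (F i)) d)

walk-suc : ∀ A n F → walk A (suc n) F ≡ step (A n) (walk A n F)
walk-suc A zero    F = refl
walk-suc A (suc n) F = walk-suc (A ∘ suc) n (step (A 0) F)

walk-+ : ∀ A m k F → walk A (m ℕ.+ k) F ≡ walk (λ j → A (m ℕ.+ j)) k (walk A m F)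
walk-+ A zero    k F = refl
walk-+ A (suc m) k F = walk-+ (A ∘ suc) m k (step (A 0) F)

walk-false : ∀ {A} k F → (∀ j → A j ≡ false) → walk A k F ≗ Δ^ k F
walk-false {A} zero    F A≡false d = refl
walk-false {A} (suc k) F A≡false d = trans
  (walk-cong k (λ _ → refl) (λ d → trans (cong (λ b → step b F d) (A≡false 0)) (ℤ.*-identityˡ _)) d)
  (walk-false k (Δ F) (A≡false ∘ suc) d)

-- Expansion of walks over sign vectors

total : ∀ {n} → Vec Sign n → ℤ
total []       = 0ℤ
total (s ∷ λs) = (s ℤ.◃ 1) ℤ.+ total λs

-- The contribution of a single path started at height `e`. A step down selects x⁻¹ with coefficient
-- 1 and a step up selects -x, whence `Sign.opposite s`.
weight : ∀ {n} → Subset n → ℤ → Vec Sign n → ℤ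
weight []      e []       = 1ℤ
weight (b ∷ S) e (s ∷ λs) =
  (Sign.opposite s ℤ.◃ 1) ℤ.* tilt b (e ℤ.+ (s ℤ.◃ 1)) ℤ.* weight S (e ℤ.+ (s ℤ.◃ 1)) λs

signs : List Sign
signs = Sign.- ∷ Sign.+ ∷ []

-- A delta function sees only its support, so `tilt` may be frozen at the centre `e`. It thereby
-- becomes a scalar, which passes through all later steps by `walk-*`.
tilt-δ : ∀ b e d → tilt b d ℤ.* δ e d ≡ tilt b e ℤ.* δ e d
tilt-δ b e d with e ℤ.≟ d
... | yes refl = refl
... | no  _    = trans (ℤ.*-zeroʳ (tilt b d)) (sym (ℤ.*-zeroʳ (tilt b e)))

step-δ : ∀ b e d → step b (δ e) d ≡
  sum signs (λ s → (Sign.opposite s ℤ.◃ 1) ℤ.* tilt b (e ℤ.+ (s ℤ.◃ 1)) ℤ.* δ (e ℤ.+ (s ℤ.◃ 1)) d)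
step-δ b e d = begin
  tilt b d ℤ.* (δ e (d ℤ.+ 1ℤ) ℤ.- δ e (d ℤ.- 1ℤ))
    ≡⟨ cong₂ (λ u v → tilt b d ℤ.* (u ℤ.- v)) (shift -1ℤ 1ℤ refl) (shift 1ℤ -1ℤ refl) ⟩
  tilt b d ℤ.* (δ (e ℤ.+ -1ℤ) d ℤ.- δ (e ℤ.+ 1ℤ) d)
    ≡⟨ distrib (tilt b d) _ _ ⟩
  tilt b d ℤ.* δ (e ℤ.+ -1ℤ) d ℤ.- tilt b d ℤ.* δ (e ℤ.+ 1ℤ) d
    ≡⟨ cong₂ ℤ._-_ (tilt-δ b (e ℤ.+ -1ℤ) d) (tilt-δ b (e ℤ.+ 1ℤ) d) ⟩
  tilt b (e ℤ.+ -1ℤ) ℤ.* δ (e ℤ.+ -1ℤ) d ℤ.- tilt b (e ℤ.+ 1ℤ) ℤ.* δ (e ℤ.+ 1ℤ) d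
    ≡⟨ ring (tilt b (e ℤ.+ -1ℤ)) _ (tilt b (e ℤ.+ 1ℤ)) _ ⟩
  sum signs (λ s → (Sign.opposite s ℤ.◃ 1) ℤ.* tilt b (e ℤ.+ (s ℤ.◃ 1)) ℤ.* δ (e ℤ.+ (s ℤ.◃ 1)) d) ∎
  where
  shift : ∀ k l → l ℤ.+ k ≡ 0ℤ → δ e (d ℤ.+ l) ≡ δ (e ℤ.+ k) d
  shift k l l+k≡0 = trans (sym (δ-+ k e (d ℤ.+ l))) (cong (δ (e ℤ.+ k))
    (trans (ℤ.+-assoc d l k) (trans (cong (ℤ._+_ d) l+k≡0) (ℤ.+-identityʳ d))))
  distrib : ∀ a b c → a ℤ.* (b ℤ.- c) ≡ a ℤ.* b ℤ.- a ℤ.* c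
  distrib = solve-∀
  ring : ∀ a b c d → a ℤ.* b ℤ.- c ℤ.* d ≡ 1ℤ ℤ.* a ℤ.* b ℤ.+ (-1ℤ ℤ.* c ℤ.* d ℤ.+ 0ℤ)
  ring = solve-∀

-- Induction on the first step, which replaces a delta function by two shifted ones; the start `e`
-- therefore has to be arbitrary.
walk-δ : ∀ A n e d → walk A n (δ e) d ≡
  sum (signVectors n) (λ λs → weight (tabulate (A ∘ toℕ)) e λs ℤ.* δ (e ℤ.+ total λs) d)
walk-δ A zero    e d = sym (trans (ℤ.+-identityʳ _)
  (trans (ℤ.*-identityˡ _) (cong (λ e → δ e d) (ℤ.+-identityʳ e))))
walk-δ A (suc n) e d = begin
  walk (A ∘ suc) n (step (A 0) (δ e)) d
    ≡⟨ walk-cong n (λ _ → refl) (step-δ (A 0) e) d ⟩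
  walk (A ∘ suc) n (λ d → sum signs (λ s → a s ℤ.* δ (e ℤ.+ (s ℤ.◃ 1)) d)) d
    ≡⟨ walk-sum (A ∘ suc) n signs (λ s d → a s ℤ.* δ (e ℤ.+ (s ℤ.◃ 1)) d) d ⟩
  sum signs (λ s → walk (A ∘ suc) n (λ d → a s ℤ.* δ (e ℤ.+ (s ℤ.◃ 1)) d) d)
    ≡⟨ sum-≗ signs (λ s → begin
         walk (A ∘ suc) n (λ d → a s ℤ.* δ (e ℤ.+ (s ℤ.◃ 1)) d) d
           ≡⟨ walk-* (A ∘ suc) n (a s) (δ (e ℤ.+ (s ℤ.◃ 1))) d ⟩
         a s ℤ.* walk (A ∘ suc) n (δ (e ℤ.+ (s ℤ.◃ 1))) d
           ≡⟨ cong (a s ℤ.*_) (walk-δ (A ∘ suc) n (e ℤ.+ (s ℤ.◃ 1)) d) ⟩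
         a s ℤ.* sum (signVectors n) _
           ≡⟨ *-sum (a s) (signVectors n) _ ⟩
         sum (signVectors n) (λ λs → a s ℤ.* (w s λs ℤ.* δ (e ℤ.+ (s ℤ.◃ 1) ℤ.+ total λs) d))
           ≡⟨ sum-≗ (signVectors n) (λ λs → trans
                (sym (ℤ.*-assoc (a s) (w s λs) _))
                (cong (λ k → a s ℤ.* w s λs ℤ.* δ k d) (ℤ.+-assoc e (s ℤ.◃ 1) (total λs)))) ⟩
         sum (signVectors n) (λ λs → a s ℤ.* w s λs ℤ.* δ (e ℤ.+ total (s ∷ λs)) d) ∎) ⟩
  sum signs (λ s → sum (signVectors n) (λ λs → a s ℤ.* w s λs ℤ.* δ (e ℤ.+ total (s ∷ λs)) d))
    ≡⟨ sum-cartesianProductWith _∷_ signs (signVectors n) _ ⟨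
  sum (signVectors (suc n)) (λ λs → weight (tabulate (A ∘ toℕ)) e λs ℤ.* δ (e ℤ.+ total λs) d) ∎
  where
  a : Sign → ℤ
  a s = (Sign.opposite s ℤ.◃ 1) ℤ.* tilt (A 0) (e ℤ.+ (s ℤ.◃ 1))
  w : Sign → Vec Sign n → ℤ
  w s = weight (tabulate (A ∘ suc ∘ toℕ)) (e ℤ.+ (s ℤ.◃ 1))

-- The condition that S(λ) contains S, relative to a starting height `e`, so that it can be handed
-- on to the tail of a path.
Positive : ∀ {n} → Subset n → ℤ → Vec Sign n → Set
Positive S e λs = ∀ {i} → i ∈ S → 0ℤ ℤ.< e ℤ.+ partialSum λs (suc (toℕ i))

Positive-∷ : ∀ {n} b {S : Subset n} e s λs →
  (b ≡ true → 0ℤ ℤ.< e ℤ.+ (s ℤ.◃ 1)) → Positive S (e ℤ.+ (s ℤ.◃ 1)) λs → Positive (b ∷ S) e (s ∷ λs)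
Positive-∷ b e s λs >0 pos Vec.here = subst (λ k → 0ℤ ℤ.< e ℤ.+ k) (sym (ℤ.+-identityʳ _)) (>0 refl)
Positive-∷ b e s λs >0 pos (Vec.there i∈S) = subst (0ℤ ℤ.<_) (ℤ.+-assoc e (s ℤ.◃ 1) _) (pos i∈S)

Positive-head : ∀ {n} {S : Subset n} e s λs → Positive (true ∷ S) e (s ∷ λs) → 0ℤ ℤ.< e ℤ.+ (s ℤ.◃ 1)
Positive-head e s λs pos = subst (λ k → 0ℤ ℤ.< e ℤ.+ k) (ℤ.+-identityʳ _) (pos Vec.here)

Positive-tail : ∀ {n} b {S : Subset n} e s λs → Positive (b ∷ S) e (s ∷ λs) →
  Positive S (e ℤ.+ (s ℤ.◃ 1)) λs
Positive-tail b e s λs pos i∈S = subst (0ℤ ℤ.<_) (sym (ℤ.+-assoc e (s ℤ.◃ 1) _)) (pos (Vec.there i∈S))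

-- The exponent counts the upward steps and the elements of S, each worth one factor -1. For an
-- upward step, the bound `minuses λs ≤ n` is what lets `suc` leave the truncated subtraction.
sign-∷ : ∀ {n} b (S : Subset n) s (λs : Vec Sign n) →
  -1ℤ ℤ.^ (suc n ℕ.∸ minuses (s ∷ λs) ℕ.+ ∣ b ∷ S ∣) ≡
  (Sign.opposite s ℤ.◃ 1) ℤ.* (if b then -1ℤ else 1ℤ) ℤ.* -1ℤ ℤ.^ (n ℕ.∸ minuses λs ℕ.+ ∣ S ∣)
sign-∷ {n} false S Sign.- λs = sym (ℤ.*-identityˡ _)
sign-∷ {n} true  S Sign.- λs = cong (-1ℤ ℤ.^_) (ℕ.+-suc (n ℕ.∸ minuses λs) ∣ S ∣)
sign-∷ {n} false S Sign.+ λs =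
  cong (λ k → -1ℤ ℤ.^ (k ℕ.+ ∣ S ∣)) (ℕ.+-∸-assoc 1 (Vec.count≤n (Sign._≟ Sign.-) λs))
sign-∷ {n} true  S Sign.+ λs = begin
  -1ℤ ℤ.^ (suc n ℕ.∸ minuses λs ℕ.+ suc ∣ S ∣)
    ≡⟨ cong (λ k → -1ℤ ℤ.^ (k ℕ.+ suc ∣ S ∣)) (ℕ.+-∸-assoc 1 (Vec.count≤n (Sign._≟ Sign.-) λs)) ⟩
  -1ℤ ℤ.^ suc (n ℕ.∸ minuses λs ℕ.+ suc ∣ S ∣)
    ≡⟨ cong (λ k → -1ℤ ℤ.^ suc k) (ℕ.+-suc (n ℕ.∸ minuses λs) ∣ S ∣) ⟩
  -1ℤ ℤ.* (-1ℤ ℤ.* -1ℤ ℤ.^ (n ℕ.∸ minuses λs ℕ.+ ∣ S ∣))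
    ≡⟨ ℤ.*-assoc -1ℤ -1ℤ _ ⟨
  1ℤ ℤ.* -1ℤ ℤ.^ (n ℕ.∸ minuses λs ℕ.+ ∣ S ∣) ∎

weight-positive : ∀ {n} (S : Subset n) e λs → Positive S e λs →
  weight S e λs ≡ -1ℤ ℤ.^ (n ℕ.∸ minuses λs ℕ.+ ∣ S ∣)
weight-positive []      e []       pos = refl
weight-positive {suc n} (b ∷ S) e (s ∷ λs) pos = begin
  (Sign.opposite s ℤ.◃ 1) ℤ.* tilt b (e ℤ.+ (s ℤ.◃ 1)) ℤ.* weight S (e ℤ.+ (s ℤ.◃ 1)) λs
    ≡⟨ cong₂ (λ t w → (Sign.opposite s ℤ.◃ 1) ℤ.* t ℤ.* w) (tilt-positive b pos)
         (weight-positive S (e ℤ.+ (s ℤ.◃ 1)) λs (Positive-tail b e s λs pos)) ⟩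
  (Sign.opposite s ℤ.◃ 1) ℤ.* (if b then -1ℤ else 1ℤ) ℤ.* -1ℤ ℤ.^ (n ℕ.∸ minuses λs ℕ.+ ∣ S ∣)
    ≡⟨ sign-∷ b S s λs ⟨
  -1ℤ ℤ.^ (suc n ℕ.∸ minuses (s ∷ λs) ℕ.+ ∣ b ∷ S ∣) ∎
  where
  tilt-positive : ∀ b → Positive (b ∷ S) e (s ∷ λs) → tilt b (e ℤ.+ (s ℤ.◃ 1)) ≡ (if b then -1ℤ else 1ℤ)
  tilt-positive false pos = refl
  tilt-positive true  pos = ⊳-yes (0ℤ ℤ.<? _) (Positive-head e s λs pos)

*-zeroʳ : ∀ a {b} → b ≡ 0ℤ → a ℤ.* b ≡ 0ℤ
*-zeroʳ a refl = ℤ.*-zeroʳ a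

-- Some marked time finds the path at height at most 0, where `tilt` vanishes. If the head is not
-- that time, the failure lies in the tail.
weight-nonpositive : ∀ {n} (S : Subset n) e λs → ¬ Positive S e λs → weight S e λs ≡ 0ℤ
weight-nonpositive []      e []       ¬pos = contradiction (λ ()) ¬pos
weight-nonpositive (false ∷ S) e (s ∷ λs) ¬pos = *-zeroʳ ((Sign.opposite s ℤ.◃ 1) ℤ.* 1ℤ)
  (weight-nonpositive S (e ℤ.+ (s ℤ.◃ 1)) λs (¬pos ∘ Positive-∷ false e s λs λ ()))
weight-nonpositive (true ∷ S) e (s ∷ λs) ¬pos with 0ℤ ℤ.<? e ℤ.+ (s ℤ.◃ 1)
... | yes >0 = *-zeroʳ ((Sign.opposite s ℤ.◃ 1) ℤ.* -1ℤ)
  (weight-nonpositive S (e ℤ.+ (s ℤ.◃ 1)) λs (¬pos ∘ Positive-∷ true e s λs λ _ → >0))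
... | no  _  = cong (ℤ._* weight S (e ℤ.+ (s ℤ.◃ 1)) λs) (ℤ.*-zeroʳ (Sign.opposite s ℤ.◃ 1))

total-minuses : ∀ {n} (λs : Vec Sign n) → total λs ≡ + n ℤ.- + (2 ℕ.* minuses λs)
total-minuses []            = refl
total-minuses {suc n} (Sign.+ ∷ λs) = trans (cong (ℤ._+_ 1ℤ) (total-minuses λs))
  (sym (ℤ.+-assoc 1ℤ (+ n) (ℤ.- + (2 ℕ.* minuses λs))))
total-minuses {suc n} (Sign.- ∷ λs) = begin
  -1ℤ ℤ.+ total λs                                   ≡⟨ cong (ℤ._+_ -1ℤ) (total-minuses λs) ⟩
  -1ℤ ℤ.+ (+ n ℤ.- + (2 ℕ.* m))                      ≡⟨ cong (λ k → -1ℤ ℤ.+ (+ n ℤ.- k)) (ℤ.pos-* 2 m) ⟩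
  -1ℤ ℤ.+ (+ n ℤ.- + 2 ℤ.* + m)                      ≡⟨ ring (+ n) (+ m) ⟩
  1ℤ ℤ.+ + n ℤ.- + 2 ℤ.* (1ℤ ℤ.+ + m)                ≡⟨ cong (ℤ._-_ (1ℤ ℤ.+ + n)) (ℤ.pos-* 2 (suc m)) ⟨
  + suc n ℤ.- + (2 ℕ.* suc m)                        ∎
  where
  m = minuses λs
  ring : ∀ n m → -1ℤ ℤ.+ (n ℤ.- + 2 ℤ.* m) ≡ 1ℤ ℤ.+ n ℤ.- + 2 ℤ.* (1ℤ ℤ.+ m)
  ring = solve-∀

∈-select⁺ : ∀ {m} {R : Pred (Fin m) ℓ} (R? : Decidable R) {i} → R i → i ∈ select R?
∈-select⁺ R? {i} r = Vec.lookup⇒[]= i _ (trans (Vec.lookup∘tabulate (does ∘ R?) i) (dec-true (R? i) r))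

⊆-positiveSums : ∀ {n} {S : Subset n} λs → S ⊆ positiveSums λs ⇔ Positive S 0ℤ λs
⊆-positiveSums λs = mk⇔
  (λ S⊆ {i} i∈S → subst (0ℤ ℤ.<_) (sym (ℤ.+-identityˡ _))
    (∈-select⁻ (λ i → 0ℤ ℤ.<? partialSum λs (suc (toℕ i))) (S⊆ i∈S)))
  (λ pos {i} i∈S → ∈-select⁺ (λ i → 0ℤ ℤ.<? partialSum λs (suc (toℕ i)))
    (subst (0ℤ ℤ.<_) (ℤ.+-identityˡ _) (pos i∈S)))

-- The inner sum of the theorem, written so that it unfolds to it definitionally.
signSum : ∀ {n} → Subset n → Laurent
signSum {n} S =
  ∑ (filter (λ λs → (S ⊆? positiveSums λs) ×-dec
                    (0ℤ ℤ.≤? + n ℤ.- + (2 ℕ.* minuses λs)))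
            (signVectors n))
    (λ λs → monomial (-1ℤ ℤ.^ (n ℕ.∸ minuses λs ℕ.+ ∣ S ∣))
                     (+ n ℤ.- + (2 ℕ.* minuses λs)))

coeff-monomial : ∀ c e d → coeff (monomial c e) d ≡ c ℤ.* δ e d
coeff-monomial c e d = trans (coeff-sum (monomial c e) d) (trans (ℤ.+-identityʳ _)
  (trans (cong (does (e ℤ.≟ d) ⊳_) (sym (ℤ.*-identityʳ c))) (sym (*-⊳ c _ 1ℤ))))

-- Both filter conditions dissolve: `weight` vanishes on the paths that violate S ⊆ S(λ), and the
-- condition on n - 2i becomes a condition on `d`, because `δ` forces the final height to be `d`.
coeff-signSum : ∀ n A d → coeff (signSum (tabulate {n = n} (A ∘ toℕ))) d ≡
  (does (0ℤ ℤ.≤? d) ⊳ walk A n (δ 0ℤ) d)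
coeff-signSum n A d = begin
  coeff (signSum S) d
    ≡⟨ coeff-∑ (filter Φ? (signVectors n)) _ d ⟩
  sum (filter Φ? (signVectors n)) (λ λs → coeff (monomial (ε λs) (end λs)) d)
    ≡⟨ sum-filter Φ? (signVectors n) _ ⟩
  sum (signVectors n) (λ λs → does (Φ? λs) ⊳ coeff (monomial (ε λs) (end λs)) d)
    ≡⟨ sum-≗ (signVectors n) summand ⟩
  sum (signVectors n) (λ λs → does (0ℤ ℤ.≤? d) ⊳ weight S 0ℤ λs ℤ.* δ (0ℤ ℤ.+ total λs) d)
    ≡⟨ sum-⊳ (does (0ℤ ℤ.≤? d)) (signVectors n) _ ⟨
  (does (0ℤ ℤ.≤? d) ⊳ sum (signVectors n) (λ λs → weight S 0ℤ λs ℤ.* δ (0ℤ ℤ.+ total λs) d))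
    ≡⟨ cong (does (0ℤ ℤ.≤? d) ⊳_) (walk-δ A n 0ℤ d) ⟨
  (does (0ℤ ℤ.≤? d) ⊳ walk A n (δ 0ℤ) d) ∎
  where
  S : Subset n
  S = tabulate (A ∘ toℕ)
  ε end : Vec Sign n → ℤ
  ε λs = -1ℤ ℤ.^ (n ℕ.∸ minuses λs ℕ.+ ∣ S ∣)
  end λs = + n ℤ.- + (2 ℕ.* minuses λs)
  Φ? : Decidable (λ λs → S ⊆ positiveSums λs × 0ℤ ℤ.≤ end λs)
  Φ? λs = (S ⊆? positiveSums λs) ×-dec (0ℤ ℤ.≤? end λs)

  weight-⊳ : ∀ λs → (does (S ⊆? positiveSums λs) ⊳ ε λs) ≡ weight S 0ℤ λs
  weight-⊳ λs with S ⊆? positiveSums λs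
  ... | yes S⊆ = sym (weight-positive S 0ℤ λs (Equivalence.to (⊆-positiveSums λs) S⊆))
  ... | no  S⊈ = sym (weight-nonpositive S 0ℤ λs λ pos → S⊈ (Equivalence.from (⊆-positiveSums λs) pos))

  ⊳-δ : ∀ a c e → (a ∧ does (0ℤ ℤ.≤? e) ⊳ c ℤ.* δ e d) ≡ (does (0ℤ ℤ.≤? d) ⊳ (a ⊳ c) ℤ.* δ e d)
  ⊳-δ a c e with e ℤ.≟ d
  ⊳-δ false c e | yes refl = sym (⊳-0 _)
  ⊳-δ true  c e | yes refl = refl
  ⊳-δ a c e | no _ = trans (cong (a ∧ does (0ℤ ℤ.≤? e) ⊳_) (ℤ.*-zeroʳ c)) (trans (⊳-0 _)
    (sym (trans (cong (does (0ℤ ℤ.≤? d) ⊳_) (ℤ.*-zeroʳ (a ⊳ c))) (⊳-0 _))))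

  summand : ∀ λs → (does (Φ? λs) ⊳ coeff (monomial (ε λs) (end λs)) d) ≡
    (does (0ℤ ℤ.≤? d) ⊳ weight S 0ℤ λs ℤ.* δ (0ℤ ℤ.+ total λs) d)
  summand λs = begin
    (does (Φ? λs) ⊳ coeff (monomial (ε λs) (end λs)) d)
      ≡⟨ cong (does (Φ? λs) ⊳_) (coeff-monomial (ε λs) (end λs) d) ⟩
    (does (Φ? λs) ⊳ ε λs ℤ.* δ (end λs) d)
      ≡⟨ ⊳-δ (does (S ⊆? positiveSums λs)) (ε λs) (end λs) ⟩
    (does (0ℤ ℤ.≤? d) ⊳ (does (S ⊆? positiveSums λs) ⊳ ε λs) ℤ.* δ (end λs) d)
      ≡⟨ cong₂ (λ w e → does (0ℤ ℤ.≤? d) ⊳ w ℤ.* δ e d) (weight-⊳ λs)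
           (trans (sym (total-minuses λs)) (sym (ℤ.+-identityˡ _))) ⟩
    (does (0ℤ ℤ.≤? d) ⊳ weight S 0ℤ λs ℤ.* δ (0ℤ ℤ.+ total λs) d) ∎

-- Subsets

x∉p─q : ∀ {m} {i : Fin m} p q → i ∈ q → ¬ i ∈ p ─ q
x∉p─q (_ ∷ p) (_ ∷ q) Vec.here        ()
x∉p─q (_ ∷ p) (_ ∷ q) (Vec.there i∈q) (Vec.there i∈) = x∉p─q p q i∈q i∈

∈-elements⁺ : ∀ {m} {Q : Subset m} {i} → i ∈ Q → i ∈ˡ elements Q
∈-elements⁺ {Q = Q} {i} = ∈-filter⁺ (_∈? Q) (∈-allFin i)

∈-elements⁻ : ∀ {m} {Q : Subset m} {i} → i ∈ˡ elements Q → i ∈ Q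
∈-elements⁻ {m} {Q} i∈ = proj₂ (∈-filter⁻ (_∈? Q) {xs = List.allFin m} i∈)

elements-unique : ∀ {m} (Q : Subset m) → Unique (elements Q)
elements-unique {m} Q = Unique.filter⁺ (_∈? Q) (Unique.allFin⁺ m)

∈-insert⁻ : ∀ {m} (C : Subset m) p {i} → i ∈ C [ p ]≔ inside → i ≡ p ⊎ i ∈ C
∈-insert⁻ (_ ∷ C) zero    Vec.here       = inj₁ refl
∈-insert⁻ (_ ∷ C) zero    (Vec.there i∈) = inj₂ (Vec.there i∈)
∈-insert⁻ (_ ∷ C) (suc p) Vec.here       = inj₂ Vec.here
∈-insert⁻ (_ ∷ C) (suc p) (Vec.there i∈) with ∈-insert⁻ C p i∈
... | inj₁ refl = inj₁ refl
... | inj₂ i∈C  = inj₂ (Vec.there i∈C)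

∈-insert⁺ : ∀ {m} {C : Subset m} p {i} → i ∈ C → i ∈ C [ p ]≔ inside
∈-insert⁺ zero    Vec.here        = Vec.here
∈-insert⁺ zero    (Vec.there i∈C) = Vec.there i∈C
∈-insert⁺ (suc p) Vec.here        = Vec.here
∈-insert⁺ (suc p) (Vec.there i∈C) = Vec.there (∈-insert⁺ p i∈C)

∈-insert : ∀ {m} (C : Subset m) p → p ∈ C [ p ]≔ inside
∈-insert C p = Vec.[]≔-updates C p

sum-subsets-∷ : ∀ n (f : Subset (suc n) → ℤ) → sum (subsets (suc n)) f ≡
  sum (subsets n) (f ∘ (inside ∷_)) ℤ.+ sum (subsets n) (f ∘ (outside ∷_))
sum-subsets-∷ n f = trans (sum-cartesianProductWith _∷_ sides (subsets n) f)
  (cong (ℤ._+_ (sum (subsets n) (f ∘ (inside ∷_)))) (ℤ.+-identityʳ _))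

-- Reindexing along the bijection that adds `p` to a subset avoiding it. At index `zero` it
-- exchanges the two halves of the enumeration.
sum-insert : ∀ {m} (p : Fin m) (H : Subset m → ℤ) →
  sum (subsets m) (λ C → does (p ∈? C) ⊳ H C) ≡
  sum (subsets m) (λ C → not (does (p ∈? C)) ⊳ H (C [ p ]≔ inside))
sum-insert {suc m} zero H = begin
  sum (subsets (suc m)) (λ C → does (zero ∈? C) ⊳ H C)
    ≡⟨ sum-subsets-∷ m _ ⟩
  sum (subsets m) (H ∘ (inside ∷_)) ℤ.+ sum (subsets m) (λ _ → 0ℤ)
    ≡⟨ ℤ.+-comm (sum (subsets m) (H ∘ (inside ∷_))) _ ⟩
  sum (subsets m) (λ _ → 0ℤ) ℤ.+ sum (subsets m) (H ∘ (inside ∷_))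
    ≡⟨ sum-subsets-∷ m (λ C → not (does (zero ∈? C)) ⊳ H (C [ zero ]≔ inside)) ⟨
  sum (subsets (suc m)) (λ C → not (does (zero ∈? C)) ⊳ H (C [ zero ]≔ inside)) ∎
sum-insert {suc m} (suc p) H = begin
  sum (subsets (suc m)) (λ C → does (suc p ∈? C) ⊳ H C)
    ≡⟨ sum-subsets-∷ m _ ⟩
  sum (subsets m) (λ C → does (p ∈? C) ⊳ H (inside ∷ C)) ℤ.+
  sum (subsets m) (λ C → does (p ∈? C) ⊳ H (outside ∷ C))
    ≡⟨ cong₂ ℤ._+_ (sum-insert p (H ∘ (inside ∷_))) (sum-insert p (H ∘ (outside ∷_))) ⟩
  sum (subsets m) (λ C → not (does (p ∈? C)) ⊳ H (inside ∷ C [ p ]≔ inside)) ℤ.+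
  sum (subsets m) (λ C → not (does (p ∈? C)) ⊳ H (outside ∷ C [ p ]≔ inside))
    ≡⟨ sum-subsets-∷ m (λ C → not (does (suc p ∈? C)) ⊳ H (C [ suc p ]≔ inside)) ⟨
  sum (subsets (suc m)) (λ C → not (does (suc p ∈? C)) ⊳ H (C [ suc p ]≔ inside)) ∎

-- Ranked posets

module _ (P : RankedPoset) where
  open RankedPoset P
  private module ⊑ = IsDecPartialOrder isDecPartialOrder

  ⊏-⊑-trans : ∀ {p q r} → p ⊏ q → q ⊑ r → p ⊏ r
  ⊏-⊑-trans (p⊑q , p≢q) q⊑r = ⊑.trans p⊑q q⊑r , λ { refl → p≢q (⊑.antisym p⊑q q⊑r) }

  -- Climb from `u`: an element strictly between `u` and `p` takes the place of `u`, until none is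
  -- left.
  lowerCover : ∀ {u p} → Acc (flip _⊏_) u → u ⊏ p → ∃ λ v → u ⊑ v × p Covers v
  lowerCover {u} {p} (acc rs) u⊏p with any? (λ r → (u ⊏? r) ×-dec (r ⊏? p))
  ... | no  ∄r = u , ⊑.refl , u⊏p , λ r u⊏r⊏p → ∄r (r , u⊏r⊏p)
  ... | yes (r , u⊏r , r⊏p) =
    let v , r⊑v , p≻v = lowerCover (rs u⊏r) r⊏p in v , ⊑.trans (proj₁ u⊏r) r⊑v , p≻v

  -- The rank is prescribed only along covers. Hence `q` is lowered to a `v` that it covers and that
  -- still lies above `p`; each such descent costs exactly one rank.
  ρ-mono : ∀ {p q} → p ⊏ q → ρ p ℕ.< ρ q
  ρ-mono = go (po-wellFounded ⊑.isPartialOrder _)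
    where
    go : ∀ {p q} → Acc _⊏_ q → p ⊏ q → ρ p ℕ.< ρ q
    go {p} (acc rs) p⊏q with lowerCover (po-noetherian ⊑.isPartialOrder p) p⊏q
    ... | v , p⊑v , q≻v with p ≟ v
    ...   | yes refl = ℕ.≤-reflexive (sym (ρ-cover q≻v))
    ...   | no  p≢v  = ℕ.<-trans (go (rs (proj₁ q≻v)) (p⊑v , p≢v)) (ℕ.≤-reflexive (sym (ρ-cover q≻v)))

  0̂⊏ : ∀ {p} → p ≢ 0̂ → 0̂ ⊏ p
  0̂⊏ p≢0̂ = minimum _ , p≢0̂ ∘ sym

  comparable-ρ : ∀ {p q} → p ⊑ q ⊎ q ⊑ p → ρ p ≡ ρ q → p ≡ q
  comparable-ρ {p} {q} cmp ρp≡ρq with p ≟ q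
  ... | yes p≡q = p≡q
  comparable-ρ (inj₁ p⊑q) ρp≡ρq | no p≢q = contradiction ρp≡ρq (ℕ.<⇒≢ (ρ-mono (p⊑q , p≢q)))
  comparable-ρ (inj₂ q⊑p) ρp≡ρq | no p≢q = contradiction (sym ρp≡ρq) (ℕ.<⇒≢ (ρ-mono (q⊑p , p≢q ∘ sym)))

  ∈-below⁺ : ∀ {Q p q} → q ∈ Q → q ⊏ p → q ∈ below P Q p
  ∈-below⁺ {Q} {p} q∈Q q⊏p = ∈-select⁺ (λ q → (q ∈? Q) ×-dec (q ⊏? p)) (q∈Q , q⊏p)

  ∈-below⁻ : ∀ {Q p q} → q ∈ below P Q p → q ∈ Q × q ⊏ p
  ∈-below⁻ {Q} {p} = ∈-select⁻ (λ q → (q ∈? Q) ×-dec (q ⊏? p))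

  ∈-removed⁻ : ∀ {Q q} → q ∈ Q - 0̂ → q ∈ Q × q ≢ 0̂
  ∈-removed⁻ {Q} q∈ = p─q⊆p Q _ q∈ , λ { refl → x∉p─q Q _ (x∈⁅x⁆ 0̂) q∈ }

  below-⊂ : ∀ {Q p} → p ∈ Q → below P Q p ⊂ Q
  below-⊂ p∈Q = proj₁ ∘ ∈-below⁻ , _ , p∈Q , λ p∈below → proj₂ (proj₂ (∈-below⁻ p∈below)) refl

  -- The recursion of t runs over sets containing 0̂, that of chains over the same sets with 0̂
  -- deleted; this lets the two descend together.
  below-removed : ∀ Q p → below P Q p - 0̂ ≡ below P (Q - 0̂) p
  below-removed Q p = ⊆-antisym
    (λ q∈ → let q∈below , q≢0̂ = ∈-removed⁻ q∈ ; q∈Q , q⊏p = ∈-below⁻ q∈below in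
      ∈-below⁺ (x∈p∧x≢y⇒x∈p-y q∈Q q≢0̂) q⊏p)
    (λ q∈ → let q∈Q- , q⊏p = ∈-below⁻ q∈ ; q∈Q , q≢0̂ = ∈-removed⁻ q∈Q- in
      x∈p∧x≢y⇒x∈p-y (∈-below⁺ q∈Q q⊏p) q≢0̂)

  DownClosed : Subset size → Set
  DownClosed Q = ∀ {p q} → p ∈ Q → q ⊑ p → q ∈ Q

  below-downClosed : ∀ {Q} p → DownClosed Q → DownClosed (below P Q p)
  below-downClosed {Q} p dc {q} {r} q∈ r⊑q = let q∈Q , q⊑p , q≢p = ∈-below⁻ {Q} q∈ in
    ∈-below⁺ (dc q∈Q r⊑q) (⊑.trans r⊑q q⊑p , λ { refl → q≢p (⊑.antisym q⊑p r⊑q) })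

  ρ≤maxRank : ∀ {Q p} → p ∈ Q → ρ p ℕ.≤ maxRank P Q
  ρ≤maxRank {Q} p∈Q = All.lookup (xs≤max 0 (map ρ (elements Q))) (∈-map⁺ ρ (∈-elements⁺ p∈Q))

  -- Since `p ≢ 0̂`, it covers some `v`, which lies in `Q` by down-closure and has rank one less;
  -- anything else below `p` has rank at most that of `v`. This synchronises the walks of [0̂,p)
  -- with those of `Q`.
  ρ≡suc-maxRank-below : ∀ {Q p} → DownClosed Q → p ∈ Q → p ≢ 0̂ → ρ p ≡ suc (maxRank P (below P Q p))
  ρ≡suc-maxRank-below {Q} {p} dc p∈Q p≢0̂
    with lowerCover (po-noetherian ⊑.isPartialOrder 0̂) (0̂⊏ p≢0̂)
  ... | v , _ , p≻v = trans (ρ-cover p≻v) (cong suc (ℕ.≤-antisym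
    (ρ≤maxRank (∈-below⁺ (dc p∈Q (proj₁ (proj₁ p≻v))) (proj₁ p≻v)))
    (max≤v⁺ ℕ.z≤n (All.tabulate rank≤))))
    where
    rank≤ : ∀ {k} → k ∈ˡ map ρ (elements (below P Q p)) → k ℕ.≤ ρ v
    rank≤ k∈ with ∈-map⁻ ρ k∈
    ... | u , u∈ , refl = ℕ.s≤s⁻¹ (subst (ρ u ℕ.<_) (ρ-cover p≻v)
      (ρ-mono (proj₂ (∈-below⁻ {Q} (∈-elements⁻ u∈)))))

  -- Chains

  IsTopOf : Fin size → Subset size → Set
  IsTopOf p C = p ∈ C × (∀ u → u ∈ C → u ⊑ p)

  isTopOf? : ∀ p C → Dec (IsTopOf p C)
  isTopOf? p C = (p ∈? C) ×-dec all? λ u → (u ∈? C) →-dec (u ⊑? p)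

  top-unique : ∀ {p q C} → IsTopOf p C → IsTopOf q C → p ≡ q
  top-unique (p∈ , ⊑p) (q∈ , ⊑q) = ⊑.antisym (⊑q _ p∈) (⊑p _ q∈)

  chain-top : ∀ {C} → IsChain P C → Nonempty C → ∃ λ p → IsTopOf p C
  chain-top {C} chain (u , u∈C) =
    let p , p∈ , ⊑p = go (elements C) (∈-elements⁺ u∈C)
                      (λ u∈ v∈ → chain _ _ (∈-elements⁻ u∈) (∈-elements⁻ v∈))
    in p , ∈-elements⁻ p∈ , λ v v∈C → ⊑p (∈-elements⁺ v∈C)
    where
    go : ∀ us {u} → u ∈ˡ us → (∀ {u v} → u ∈ˡ us → v ∈ˡ us → u ⊑ v ⊎ v ⊑ u) →
         ∃ λ p → p ∈ˡ us × (∀ {v} → v ∈ˡ us → v ⊑ p)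
    go (u ∷ [])     _ cmp = u , here refl , λ { (here refl) → ⊑.refl }
    go (u ∷ v ∷ us) _ cmp with go (v ∷ us) (here refl) (λ u∈ v∈ → cmp (there u∈) (there v∈))
    ... | p , p∈ , ⊑p with cmp (here refl) (there p∈)
    ...   | inj₁ u⊑p = p , there p∈ , λ { (here refl) → u⊑p ; (there v∈) → ⊑p v∈ }
    ...   | inj₂ p⊑u = u , here refl , λ { (here refl) → ⊑.refl ; (there v∈) → ⊑.trans (⊑p v∈) p⊑u }

  insert-chain : ∀ {R p C} → p ∈ R → ¬ p ∈ C →
    (IsTopOf p (C [ p ]≔ inside) × IsChainOf P R (C [ p ]≔ inside)) ⇔ IsChainOf P (below P R p) C
  insert-chain {R} {p} {C} p∈R p∉C = mk⇔
    (λ ((_ , ⊑p) , C′⊆R , chain) →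
        (λ {u} u∈C → ∈-below⁺ (C′⊆R (∈-insert⁺ p u∈C)) (⊑p u (∈-insert⁺ p u∈C) , λ { refl → p∉C u∈C }))
      , λ u v u∈C v∈C → chain u v (∈-insert⁺ p u∈C) (∈-insert⁺ p v∈C))
    (λ (C⊆ , chain) →
        (∈-insert C p , λ u u∈ → ⊑p C⊆ (∈-insert⁻ C p u∈))
      , (λ u∈ → ⊆R C⊆ (∈-insert⁻ C p u∈))
      , λ u v u∈ v∈ → cmp C⊆ chain (∈-insert⁻ C p u∈) (∈-insert⁻ C p v∈))
    where
    ⊑p : ∀ {u} → C ⊆ below P R p → u ≡ p ⊎ u ∈ C → u ⊑ p
    ⊑p C⊆ (inj₁ refl) = ⊑.refl
    ⊑p C⊆ (inj₂ u∈C)  = proj₁ (proj₂ (∈-below⁻ {R} (C⊆ u∈C)))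
    ⊆R : ∀ {u} → C ⊆ below P R p → u ≡ p ⊎ u ∈ C → u ∈ R
    ⊆R C⊆ (inj₁ refl) = p∈R
    ⊆R C⊆ (inj₂ u∈C)  = proj₁ (∈-below⁻ {R} (C⊆ u∈C))
    cmp : ∀ {u v} → C ⊆ below P R p → IsChain P C → u ≡ p ⊎ u ∈ C → v ≡ p ⊎ v ∈ C → u ⊑ v ⊎ v ⊑ u
    cmp C⊆ chain u∈         (inj₁ refl) = inj₁ (⊑p C⊆ u∈)
    cmp C⊆ chain (inj₁ refl) v∈         = inj₂ (⊑p C⊆ v∈)
    cmp C⊆ chain (inj₂ u∈C) (inj₂ v∈C)  = chain _ _ u∈C v∈C

  -- Matches the shape of the recursion of t: `G ⊥` corresponds to the isolated power of x⁻¹ - x,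
  -- and the sum over `elements R` to the sum over p.
  sum-chains : ∀ R (G : Subset size → ℤ) →
    sum (subsets size) (λ C → does (isChainOf? P R C) ⊳ G C) ≡
    G ⊥ ℤ.+ sum (elements R) (λ p →
      sum (subsets size) (λ C → does (isChainOf? P (below P R p) C) ⊳ G (C [ p ]≔ inside)))
  sum-chains R G = begin
    sum (subsets size) (λ C → does (isChainOf? P R C) ⊳ G C)
      ≡⟨ sum-≗ (subsets size) byTop ⟩
    sum (subsets size) (λ C → (does (¬? (nonempty? C)) ⊳ G C) ℤ.+ sum (elements R) (λ p → topped p C))
      ≡⟨ sum-+ (subsets size) _ _ ⟩
    sum (subsets size) (λ C → does (¬? (nonempty? C)) ⊳ G C) ℤ.+
    sum (subsets size) (λ C → sum (elements R) (λ p → topped p C))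
      ≡⟨ cong₂ ℤ._+_ onlyEmpty (sum-comm (subsets size) (elements R) (flip topped)) ⟩
    G ⊥ ℤ.+ sum (elements R) (λ p → sum (subsets size) (topped p))
      ≡⟨ cong (ℤ._+_ (G ⊥)) (sum-cong (elements R) (removeTop ∘ ∈-elements⁻)) ⟩
    G ⊥ ℤ.+ sum (elements R) (λ p →
      sum (subsets size) (λ C → does (isChainOf? P (below P R p) C) ⊳ G (C [ p ]≔ inside))) ∎
    where
    topped : Fin size → Subset size → ℤ
    topped p C = does (isTopOf? p C ×-dec isChainOf? P R C) ⊳ G C

    nonempty : ∀ C → Nonempty C → Dec (IsChainOf P R C) →
      (does (isChainOf? P R C) ⊳ G C) ≡ sum (elements R) (λ p → topped p C)
    nonempty C ∃u (no ¬chain) = trans (⊳-no (isChainOf? P R C) ¬chain)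
      (sym (sum-≡0 (elements R) λ {p} _ → ⊳-no (isTopOf? p C ×-dec isChainOf? P R C) (¬chain ∘ proj₂)))
    nonempty C ∃u (yes (C⊆R , chain)) with chain-top chain ∃u
    ... | t , t-top = begin
      (does (isChainOf? P R C) ⊳ G C)
        ≡⟨ ⊳-yes (isChainOf? P R C) (C⊆R , chain) ⟩
      G C
        ≡⟨ ⊳-yes (isTopOf? t C ×-dec isChainOf? P R C) (t-top , C⊆R , chain) ⟨
      topped t C
        ≡⟨ sum-unique (λ p → topped p C) (elements-unique R) (∈-elements⁺ (C⊆R (proj₁ t-top)))
             (λ {p} _ p≢t → ⊳-no (isTopOf? p C ×-dec isChainOf? P R C)
               λ (p-top , _) → p≢t (top-unique p-top t-top)) ⟨
      sum (elements R) (λ p → topped p C) ∎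

    byTop : ∀ C → (does (isChainOf? P R C) ⊳ G C) ≡
      (does (¬? (nonempty? C)) ⊳ G C) ℤ.+ sum (elements R) (λ p → topped p C)
    byTop C with nonempty? C
    ... | no ∄u = begin
      (does (isChainOf? P R C) ⊳ G C)
        ≡⟨ ⊳-yes (isChainOf? P R C)
             ((λ u∈ → contradiction (_ , u∈) ∄u) , λ u _ u∈ → contradiction (u , u∈) ∄u) ⟩
      G C
        ≡⟨ ℤ.+-identityʳ (G C) ⟨
      G C ℤ.+ 0ℤ
        ≡⟨ cong (ℤ._+_ (G C)) (sum-≡0 (elements R) λ {p} _ →
             ⊳-no (isTopOf? p C ×-dec isChainOf? P R C) λ ((p∈C , _) , _) → ∄u (p , p∈C)) ⟨
      G C ℤ.+ sum (elements R) (λ p → topped p C) ∎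
    ... | yes ∃u = trans (nonempty C ∃u (isChainOf? P R C)) (sym (ℤ.+-identityˡ _))

    onlyEmpty : sum (subsets size) (λ C → does (¬? (nonempty? C)) ⊳ G C) ≡ G ⊥
    onlyEmpty = trans
      (sum-unique _ (subsets-unique size) (∈-subsets ⊥) λ {C} _ C≢⊥ →
        ⊳-no (¬? (nonempty? C)) (C≢⊥ ∘ Empty-unique))
      (⊳-yes (¬? (nonempty? (⊥ {size}))) λ (u , u∈⊥) → ∉⊥ u∈⊥)

    removeTop : ∀ {p} → p ∈ R → sum (subsets size) (topped p) ≡
      sum (subsets size) (λ C → does (isChainOf? P (below P R p) C) ⊳ G (C [ p ]≔ inside))
    removeTop {p} p∈R = begin
      sum (subsets size) (topped p)
        -- `topped p C` vanishes unless `p ∈ C`, so the guard demanded by `sum-insert` may be put in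
        -- front.
        ≡⟨ sum-≗ (subsets size) contains ⟨
      sum (subsets size) (λ C → does (p ∈? C) ⊳ topped p C)
        ≡⟨ sum-insert p (topped p) ⟩
      sum (subsets size) (λ C → not (does (p ∈? C)) ⊳ topped p (C [ p ]≔ inside))
        ≡⟨ sum-≗ (subsets size) remove ⟩
      sum (subsets size) (λ C → does (isChainOf? P (below P R p) C) ⊳ G (C [ p ]≔ inside)) ∎
      where
      contains : ∀ C → (does (p ∈? C) ⊳ topped p C) ≡ topped p C
      contains C with p ∈? C
      ... | yes _ = refl
      ... | no  _ = refl
      remove : ∀ C → (not (does (p ∈? C)) ⊳ topped p (C [ p ]≔ inside)) ≡
        (does (isChainOf? P (below P R p) C) ⊳ G (C [ p ]≔ inside))
      remove C with p ∈? C
      -- Here the left side is 0, and so is the right one: a chain below `p` cannot contain `p`.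
      ... | yes p∈C = sym (⊳-no (isChainOf? P (below P R p) C) λ (C⊆ , _) →
        proj₂ (proj₂ (∈-below⁻ {R} (C⊆ p∈C))) refl)
      ... | no  p∉C = cong (_⊳ G (C [ p ]≔ inside)) (does-⇔ (insert-chain p∈R p∉C)
        (isTopOf? p C′ ×-dec isChainOf? P R C′) (isChainOf? P (below P R p) C))
        where
        C′ : Subset size
        C′ = C [ p ]≔ inside

  -- Unfolding the recursion over chains

  -- A predicate on all of `ℕ`, not a `Subset n`: a chain of [0̂,p) and its extension by `p` belong
  -- to walks of different lengths and still have to be compared.
  hasRank : Subset size → ℕ → Bool
  hasRank C j = does (any? λ u → (u ∈? C) ×-dec (ρ u ℕ.≟ suc j))

  chainWalks : Subset size → ℕ → ℤ → ℤ
  chainWalks R n d = sum (subsets size) λ C → does (isChainOf? P R C) ⊳ walk (hasRank C) n (δ 0ℤ) d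

  -- Up to rank `r` the element `p` changes nothing, and above `r` the extended chain has the rank
  -- of `p` only. So among the last `suc k` steps just the first is marked, which `ℕ._≡ᵇ 0` encodes.
  walk-insert : ∀ {C p r k n} → C ⊆ below P ⊤ p → ρ p ≡ suc r → n ≡ r ℕ.+ suc k →
    walk (ℕ._≡ᵇ 0) (suc k) (walk (hasRank C) r (δ 0ℤ)) ≗ walk (hasRank (C [ p ]≔ inside)) n (δ 0ℤ)
  walk-insert {C} {p} {r} {k} C⊆ ρp≡ refl d = begin
    walk (ℕ._≡ᵇ 0) (suc k) (walk (hasRank C) r (δ 0ℤ)) d
      ≡⟨ walk-cong (suc k) (λ {j} _ → sym (upper j)) (walk-cong r (sym ∘ lower) λ _ → refl) d ⟩
    walk (λ j → hasRank C′ (r ℕ.+ j)) (suc k) (walk (hasRank C′) r (δ 0ℤ)) d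
      ≡⟨ cong (λ F → F d) (walk-+ (hasRank C′) r (suc k) (δ 0ℤ)) ⟨
    walk (hasRank C′) (r ℕ.+ suc k) (δ 0ℤ) d ∎
    where
    C′ : Subset size
    C′ = C [ p ]≔ inside
    rank? : ∀ C j → Dec (∃ λ u → u ∈ C × ρ u ≡ suc j)
    rank? C j = any? λ u → (u ∈? C) ×-dec (ρ u ℕ.≟ suc j)
    lower : ∀ {j} → j ℕ.< r → hasRank C′ j ≡ hasRank C j
    lower {j} j<r = does-⇔ (mk⇔
      (λ (u , u∈ , ρu≡) → u , old ρu≡ (∈-insert⁻ C p u∈) , ρu≡)
      (λ (u , u∈ , ρu≡) → u , ∈-insert⁺ p u∈ , ρu≡)) (rank? C′ j) (rank? C j)
      where
      old : ∀ {u} → ρ u ≡ suc j → u ≡ p ⊎ u ∈ C → u ∈ C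
      old ρu≡ (inj₁ refl) = contradiction (ℕ.suc-injective (trans (sym ρu≡) ρp≡)) (ℕ.<⇒≢ j<r)
      old ρu≡ (inj₂ u∈C)  = u∈C
    rank≤ : ∀ {u} → u ≡ p ⊎ u ∈ C → ρ u ℕ.≤ suc r
    rank≤ (inj₁ refl) = ℕ.≤-reflexive ρp≡
    rank≤ (inj₂ u∈C)  = ℕ.≤-trans (ℕ.<⇒≤ (ρ-mono (proj₂ (∈-below⁻ {⊤} (C⊆ u∈C))))) (ℕ.≤-reflexive ρp≡)
    upper : ∀ j → hasRank C′ (r ℕ.+ j) ≡ (j ℕ.≡ᵇ 0)
    upper zero    = dec-true (rank? C′ (r ℕ.+ 0))
      (p , ∈-insert C p , trans ρp≡ (cong suc (sym (ℕ.+-identityʳ r))))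
    upper (suc j) = dec-false (rank? C′ (r ℕ.+ suc j)) λ (u , u∈ , ρu≡) →
      ℕ.<⇒≱ (ℕ.m<m+n r ℕ.z<s) (ℕ.s≤s⁻¹ (subst (ℕ._≤ suc r) ρu≡ (rank≤ (∈-insert⁻ C p u∈))))

  -- U≥1 makes the truncation U≥0 one step earlier redundant.
  step-true : ∀ F e → (does (1ℤ ℤ.≤? e) ⊳ ℤ.- Δ (λ d → does (0ℤ ℤ.≤? d) ⊳ F d) e) ≡ step true F e
  step-true F (+ zero)     = refl
  step-true F (+ suc n)    = sym (ℤ.-1*i≡-i (Δ F (+ suc n)))
  step-true F (ℤ.-[1+ n ]) = refl

  -- Induction along `_⊂_`. Down-closed sets containing 0̂ are stable under passing to `below P Q p`
  -- for `p ≢ 0̂`, so every recursive call again meets a nonempty set with minimum 0̂.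
  coeff-toric : ∀ {Q} → DownClosed Q → 0̂ ∈ Q → ∀ d →
    coeff (toric P Q) d ≡ (does (0ℤ ℤ.≤? d) ⊳ chainWalks (Q - 0̂) (maxRank P Q) d)
  coeff-toric = go (⊂-wellFounded _)
    where
    go : ∀ {Q} → Acc _⊂_ Q → DownClosed Q → 0̂ ∈ Q → ∀ d →
      coeff (toric P Q) d ≡ (does (0ℤ ℤ.≤? d) ⊳ chainWalks (Q - 0̂) (maxRank P Q) d)
    go {Q} (acc rs) dc 0̂∈Q d = begin
      coeff (toric P Q) d
        ≡⟨ cong (λ f → coeff f d) (toric-rec P (0̂ , 0̂∈Q)) ⟩
      coeff (U≥ 0ℤ ((x⁻¹ ⊖ x) ^ n ⊕ ∑ (elements R) summand)) d
        ≡⟨ coeff-U≥ 0ℤ ((x⁻¹ ⊖ x) ^ n ⊕ ∑ (elements R) summand) d ⟩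
      (does (0ℤ ℤ.≤? d) ⊳ coeff ((x⁻¹ ⊖ x) ^ n ⊕ ∑ (elements R) summand) d)
        ≡⟨ cong (does (0ℤ ℤ.≤? d) ⊳_) (begin
             coeff ((x⁻¹ ⊖ x) ^ n ⊕ ∑ (elements R) summand) d
               ≡⟨ coeff-⊕ ((x⁻¹ ⊖ x) ^ n) (∑ (elements R) summand) d ⟩
             coeff ((x⁻¹ ⊖ x) ^ n) d ℤ.+ coeff (∑ (elements R) summand) d
               ≡⟨ cong₂ ℤ._+_ empty (trans (coeff-∑ (elements R) summand d)
                    (sum-cong (elements R) (coeff-summand ∘ ∈-elements⁻))) ⟩
             G ⊥ ℤ.+ sum (elements R) (λ p →
               sum (subsets size) (λ C → does (isChainOf? P (below P R p) C) ⊳ G (C [ p ]≔ inside)))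
               ≡⟨ sum-chains R G ⟨
             chainWalks R n d ∎) ⟩
      (does (0ℤ ℤ.≤? d) ⊳ chainWalks R n d) ∎
      where
      n : ℕ
      n = maxRank P Q
      R : Subset size
      R = Q - 0̂
      G : Subset size → ℤ
      G C = walk (hasRank C) n (δ 0ℤ) d
      inner summand : Fin size → Laurent
      inner p = U≥ 1ℤ (toric P (below P Q p) ⊗ (x ⊖ x⁻¹))
      summand p = inner p ⊗ (x⁻¹ ⊖ x) ^ (n ℕ.∸ ρ p)

      empty : coeff ((x⁻¹ ⊖ x) ^ n) d ≡ G ⊥
      empty = begin
        coeff ((x⁻¹ ⊖ x) ^ n) d           ≡⟨ coeff-⟦⟧ ((x⁻¹ ⊖ x) ^ n) d ⟩
        ⟦ (x⁻¹ ⊖ x) ^ n ⟧ (δ 0ℤ) d        ≡⟨ ⟦⟧-^ n (δ 0ℤ) d ⟩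
        Δ^ n (δ 0ℤ) d                     ≡⟨ walk-false n (δ 0ℤ) (λ j → dec-false
                                               (any? λ u → (u ∈? ⊥) ×-dec (ρ u ℕ.≟ suc j))
                                               λ (u , u∈⊥ , _) → ∉⊥ u∈⊥) d ⟨
        G ⊥                               ∎

      coeff-inner : ∀ {p} → p ∈ Q → p ≢ 0̂ → let r = maxRank P (below P Q p) in
        coeff (inner p) ≗ step true (chainWalks (below P R p) r)
      coeff-inner {p} p∈Q p≢0̂ e = begin
        coeff (inner p) e
          ≡⟨ coeff-U≥ 1ℤ (toric P (below P Q p) ⊗ (x ⊖ x⁻¹)) e ⟩
        (does (1ℤ ℤ.≤? e) ⊳ coeff (toric P (below P Q p) ⊗ (x ⊖ x⁻¹)) e)
          ≡⟨ cong (does (1ℤ ℤ.≤? e) ⊳_) (begin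
               coeff (toric P (below P Q p) ⊗ (x ⊖ x⁻¹)) e
                 ≡⟨ coeff-⊗ (toric P (below P Q p)) (x ⊖ x⁻¹) e ⟩
               ⟦ x ⊖ x⁻¹ ⟧ (coeff (toric P (below P Q p))) e
                 ≡⟨ ⟦⟧-cong (x ⊖ x⁻¹) (go (rs (below-⊂ p∈Q))
                      (below-downClosed p dc) (∈-below⁺ 0̂∈Q (0̂⊏ p≢0̂))) e ⟩
               ⟦ x ⊖ x⁻¹ ⟧ (λ d → does (0ℤ ℤ.≤? d) ⊳ chainWalks (below P Q p - 0̂) r d) e
                 ≡⟨ ⟦x⊖x⁻¹⟧ (λ d → does (0ℤ ℤ.≤? d) ⊳ chainWalks (below P Q p - 0̂) r d) e ⟩
               ℤ.- Δ (λ d → does (0ℤ ℤ.≤? d) ⊳ chainWalks (below P Q p - 0̂) r d) e ∎) ⟩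
        (does (1ℤ ℤ.≤? e) ⊳ ℤ.- Δ (λ d → does (0ℤ ℤ.≤? d) ⊳ chainWalks (below P Q p - 0̂) r d) e)
          ≡⟨ step-true (chainWalks (below P Q p - 0̂) r) e ⟩
        step true (chainWalks (below P Q p - 0̂) r) e
          ≡⟨ cong (λ S → step true (chainWalks S r) e) (below-removed Q p) ⟩
        step true (chainWalks (below P R p) r) e ∎
        where
        r : ℕ
        r = maxRank P (below P Q p)

      coeff-summand : ∀ {p} → p ∈ R → coeff (summand p) d ≡
        sum (subsets size) (λ C → does (isChainOf? P (below P R p) C) ⊳ G (C [ p ]≔ inside))
      coeff-summand {p} p∈R with ∈-removed⁻ p∈R
      ... | p∈Q , p≢0̂ = begin
        coeff (summand p) d
          ≡⟨ coeff-⊗ (inner p) ((x⁻¹ ⊖ x) ^ k) d ⟩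
        ⟦ (x⁻¹ ⊖ x) ^ k ⟧ (coeff (inner p)) d
          ≡⟨ ⟦⟧-^ k (coeff (inner p)) d ⟩
        Δ^ k (coeff (inner p)) d
          ≡⟨ Δ^-cong k (coeff-inner p∈Q p≢0̂) d ⟩
        Δ^ k (step true (chainWalks (below P R p) r)) d
          -- The tilted step and the `k` free ones form one walk whose only marked index is 0; at
          -- successors `ℕ._≡ᵇ 0` computes to `false`.
          ≡⟨ walk-false k (step true (chainWalks (below P R p) r)) (λ _ → refl) d ⟨
        walk (ℕ._≡ᵇ 0) (suc k) (chainWalks (below P R p) r) d
          ≡⟨ walk-sum (ℕ._≡ᵇ 0) (suc k) (subsets size)
               (λ C d → chain C ⊳ walk (hasRank C) r (δ 0ℤ) d) d ⟩
        sum (subsets size) (λ C →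
          walk (ℕ._≡ᵇ 0) (suc k) (λ d → chain C ⊳ walk (hasRank C) r (δ 0ℤ) d) d)
          ≡⟨ sum-≗ (subsets size) (λ C → trans
               (walk-⊳ (ℕ._≡ᵇ 0) (suc k) (chain C) (walk (hasRank C) r (δ 0ℤ)) d)
               (⊳-cong (isChainOf? P (below P R p) C) λ (C⊆ , _) →
                 walk-insert (λ u∈C → ∈-below⁺ ∈⊤ (proj₂ (∈-below⁻ {R} (C⊆ u∈C)))) ρp≡ n≡ d)) ⟩
        sum (subsets size) (λ C → chain C ⊳ G (C [ p ]≔ inside)) ∎
        where
        k r : ℕ
        k = n ℕ.∸ ρ p
        r = maxRank P (below P Q p)
        chain : Subset size → Bool
        chain C = does (isChainOf? P (below P R p) C)
        ρp≡ : ρ p ≡ suc r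
        ρp≡ = ρ≡suc-maxRank-below dc p∈Q p≢0̂
        n≡ : n ≡ r ℕ.+ suc k
        n≡ = begin
          n                ≡⟨ ℕ.m+[n∸m]≡n (ρ≤maxRank p∈Q) ⟨
          ρ p ℕ.+ k        ≡⟨ cong (ℕ._+ k) ρp≡ ⟩
          suc r ℕ.+ k      ≡⟨ ℕ.+-suc r k ⟨
          r ℕ.+ suc k      ∎

  -- Rank sets and flag numbers

  rankSet : ∀ n → Subset size → Subset n
  rankSet n C = tabulate (hasRank C ∘ toℕ)

  IsFlagChain : ∀ {n} → Subset n → Subset size → Set
  IsFlagChain S C = IsMaximalChainOf P (rankSelected P S) C × MeetsRanks P S C

  isFlagChain? : ∀ {n} (S : Subset n) → Decidable (IsFlagChain S)
  isFlagChain? S C = isMaximalChainOf? P (rankSelected P S) C ×-dec meetsRanks? P S C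

  ∈-rankSelected⁻ : ∀ {n} {S : Subset n} {u} → u ∈ rankSelected P S →
    ∃ λ i → i ∈ S × ρ u ≡ suc (toℕ i)
  ∈-rankSelected⁻ {S = S} = ∈-select⁻ λ u → any? λ i → (i ∈? S) ×-dec (ρ u ℕ.≟ suc (toℕ i))

  ∈-rankSelected⁺ : ∀ {n} {S : Subset n} {u} → (∃ λ i → i ∈ S × ρ u ≡ suc (toℕ i)) →
    u ∈ rankSelected P S
  ∈-rankSelected⁺ {S = S} = ∈-select⁺ λ u → any? λ i → (i ∈? S) ×-dec (ρ u ℕ.≟ suc (toℕ i))

  ∈-rankSet⁻ : ∀ {n C} {i : Fin n} → i ∈ rankSet n C → ∃ λ u → u ∈ C × ρ u ≡ suc (toℕ i)
  ∈-rankSet⁻ {C = C} = ∈-select⁻ λ i → any? λ u → (u ∈? C) ×-dec (ρ u ℕ.≟ suc (toℕ i))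

  ∈-rankSet⁺ : ∀ {n C} {i : Fin n} → (∃ λ u → u ∈ C × ρ u ≡ suc (toℕ i)) → i ∈ rankSet n C
  ∈-rankSet⁺ {C = C} = ∈-select⁺ λ i → any? λ u → (u ∈? C) ×-dec (ρ u ℕ.≟ suc (toℕ i))

  flagChain⇒chain : ∀ {n} {S : Subset n} {C} → IsFlagChain S C → IsChainOf P (⊤ - 0̂) C
  flagChain⇒chain {S = S} (((C⊆ , chain) , _) , _) =
    (λ u∈C → x∈p∧x≢y⇒x∈p-y ∈⊤ (≢0̂ (∈-rankSelected⁻ {S = S} (C⊆ u∈C)))) , chain
    where
    ≢0̂ : ∀ {u} → (∃ λ i → i ∈ S × ρ u ≡ suc (toℕ i)) → u ≢ 0̂
    ≢0̂ (i , _ , ρu≡) refl with () ← trans (sym ρ-0̂) ρu≡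

  -- `MeetsRanks` puts S inside the rank set, and membership in P_S gives the converse. A chain is
  -- thus counted for at most one S.
  flagChain⇒rankSet : ∀ {n} {S : Subset n} {C} → IsFlagChain S C → S ≡ rankSet n C
  flagChain⇒rankSet {S = S} {C} (((C⊆ , _) , _) , meets) = ⊆-antisym
    (λ i∈S → ∈-rankSet⁺ {C = C} (meets _ i∈S))
    (λ i∈ → let u , u∈C , ρu≡ = ∈-rankSet⁻ {C = C} i∈
                i′ , i′∈S , ρu≡′ = ∈-rankSelected⁻ {S = S} (C⊆ u∈C) in
      subst (_∈ S) (toℕ-injective (ℕ.suc-injective (trans (sym ρu≡′) ρu≡))) i′∈S)

  chain⇒flagChain : ∀ {C} → IsChainOf P (⊤ - 0̂) C → IsFlagChain (rankSet (maxRank P ⊤) C) C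
  chain⇒flagChain {C} (C⊆ , chain) = ((C⊆P_S , chain) , maximal) , λ i i∈ → ∈-rankSet⁻ {C = C} i∈
    where
    S : Subset (maxRank P ⊤)
    S = rankSet (maxRank P ⊤) C

    rankIndex : ∀ {u} → u ≢ 0̂ → ∃ λ (i : Fin (maxRank P ⊤)) → ρ u ≡ suc (toℕ i)
    -- The second scrutinee rules out rank 0, which would lie strictly above `ρ 0̂`.
    rankIndex {u} u≢0̂ with ρ u in eq | ρ-mono (0̂⊏ u≢0̂)
    ... | suc k | _ = Fin.fromℕ< k<n , cong suc (sym (toℕ-fromℕ< k<n))
      where
      k<n : k ℕ.< maxRank P ⊤
      k<n = subst (ℕ._≤ maxRank P ⊤) eq (ρ≤maxRank ∈⊤)

    C⊆P_S : C ⊆ rankSelected P S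
    C⊆P_S {u} u∈C = let i , ρu≡ = rankIndex (proj₂ (∈-removed⁻ {⊤} (C⊆ u∈C))) in
      ∈-rankSelected⁺ (i , ∈-rankSet⁺ {C = C} (u , u∈C , ρu≡) , ρu≡)

    -- Elements of equal rank are incomparable, so C already exhausts the ranks in S.
    maximal : ¬ (∃ λ D → IsChainOf P (rankSelected P S) D × C ⊂ D)
    maximal (D , (D⊆ , D-chain) , C⊆D , v , v∈D , v∉C) =
      let i , i∈S , ρv≡ = ∈-rankSelected⁻ {S = S} (D⊆ v∈D)
          u , u∈C , ρu≡ = ∈-rankSet⁻ {C = C} i∈S
      in v∉C (subst (_∈ C) (comparable-ρ (D-chain u v (C⊆D u∈C) v∈D) (trans ρu≡ (sym ρv≡))) u∈C)

  -- Every chain avoiding 0̂ is a flag chain for exactly one S, its rank set, and no other subset of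
  -- P is a flag chain for any S.
  sum-flagChains : ∀ C (f : Subset (maxRank P ⊤) → ℤ) → let n = maxRank P ⊤ in
    sum (subsets n) (λ S → does (isFlagChain? S C) ⊳ f S) ≡
    (does (isChainOf? P (⊤ - 0̂) C) ⊳ f (rankSet n C))
  sum-flagChains C f = go (isChainOf? P (⊤ - 0̂) C)
    where
    n : ℕ
    n = maxRank P ⊤
    go : Dec (IsChainOf P (⊤ - 0̂) C) →
      sum (subsets n) (λ S → does (isFlagChain? S C) ⊳ f S) ≡
      (does (isChainOf? P (⊤ - 0̂) C) ⊳ f (rankSet n C))
    go (no ¬chain) = trans
      (sum-≡0 (subsets n) λ {S} _ → ⊳-no (isFlagChain? S C) (¬chain ∘ flagChain⇒chain))
      (sym (⊳-no (isChainOf? P (⊤ - 0̂) C) ¬chain))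
    go (yes chain) = begin
      sum (subsets n) (λ S → does (isFlagChain? S C) ⊳ f S)
        ≡⟨ sum-unique _ (subsets-unique n) (∈-subsets (rankSet n C))
             (λ {S} _ S≢ → ⊳-no (isFlagChain? S C) (S≢ ∘ flagChain⇒rankSet)) ⟩
      (does (isFlagChain? (rankSet n C) C) ⊳ f (rankSet n C))
        ≡⟨ ⊳-yes (isFlagChain? (rankSet n C) C) (chain⇒flagChain chain) ⟩
      f (rankSet n C)
        ≡⟨ ⊳-yes (isChainOf? P (⊤ - 0̂) C) chain ⟨
      (does (isChainOf? P (⊤ - 0̂) C) ⊳ f (rankSet n C)) ∎

proposition3p8 : (P : RankedPoset) →
    let n = maxRank P ⊤ in
    toric P ⊤ ≈
      ∑ (subsets n) (λ S →
        + flagNumber P S ·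
          ∑ (filter (λ λs → (S ⊆? positiveSums λs) ×-dec
                            (0ℤ ℤ.≤? + n ℤ.- + (2 ℕ.* minuses λs)))
                    (signVectors n))
            (λ λs → monomial (-1ℤ ℤ.^ (n ℕ.∸ minuses λs ℕ.+ ∣ S ∣))
                             (+ n ℤ.- + (2 ℕ.* minuses λs))))
proposition3p8 P d = begin
  coeff (toric P ⊤) d
    ≡⟨ coeff-toric P (λ _ _ → ∈⊤) ∈⊤ d ⟩
  (does (0ℤ ℤ.≤? d) ⊳ chainWalks P (⊤ - 0̂) n d)
    ≡⟨ sum-⊳ (does (0ℤ ℤ.≤? d)) (subsets size) _ ⟩
  sum (subsets size) (λ C → does (0ℤ ℤ.≤? d) ⊳ chain C ⊳ walk (hasRank P C) n (δ 0ℤ) d)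
    ≡⟨ sum-≗ (subsets size) (λ C → begin
         (does (0ℤ ℤ.≤? d) ⊳ chain C ⊳ walk (hasRank P C) n (δ 0ℤ) d)
           ≡⟨ ⊳-comm (does (0ℤ ℤ.≤? d)) (chain C) _ ⟩
         (chain C ⊳ does (0ℤ ℤ.≤? d) ⊳ walk (hasRank P C) n (δ 0ℤ) d)
           ≡⟨ cong (chain C ⊳_) (coeff-signSum n (hasRank P C) d) ⟨
         (chain C ⊳ coeff (signSum (rankSet P n C)) d)
           ≡⟨ sum-flagChains P C (λ S → coeff (signSum S) d) ⟨
         sum (subsets n) (λ S → does (isFlagChain? P S C) ⊳ coeff (signSum S) d) ∎) ⟩
  sum (subsets size) (λ C → sum (subsets n) (λ S → does (isFlagChain? P S C) ⊳ coeff (signSum S) d))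
    -- Double counting of pairs (C, S): for fixed S the summand no longer depends on C apart from
    -- its guard, so the inner sum becomes a multiple by f_S(P).
    ≡⟨ sum-comm (subsets size) (subsets n) (λ C S → does (isFlagChain? P S C) ⊳ coeff (signSum S) d) ⟩
  sum (subsets n) (λ S → sum (subsets size) (λ C → does (isFlagChain? P S C) ⊳ coeff (signSum S) d))
    ≡⟨ sum-≗ (subsets n) (λ S → trans
         (sym (length-filter-* (isFlagChain? P S) (subsets size) (coeff (signSum S) d)))
         (sym (coeff-· (+ flagNumber P S) (signSum S) d))) ⟩
  sum (subsets n) (λ S → coeff (+ flagNumber P S · signSum S) d)
    ≡⟨ coeff-∑ (subsets n) (λ S → + flagNumber P S · signSum S) d ⟨
  coeff (∑ (subsets n) (λ S → + flagNumber P S · signSum S)) d ∎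
  where
  open RankedPoset P using (size; 0̂)
  n : ℕ
  n = maxRank P ⊤
  chain : Subset size → Bool
  chain C = does (isChainOf? P (⊤ - 0̂) C)
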